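{- Fix an integer $t\ge 0$, an integer $d\ge2$ and a real $\mu\ge1$. Any graph $G$ with $N$ nodes, maximum node degree $\Delta$ and treewidth at most $t$ can be embedded into any $d$-dimensional grid with at least $N$ nodes and aspect ratio at most $\mu$, with an edge-congestion of $O(\Delta)$. Here the constant implied by $O(\cdot)$ depends only on $t$, $d$ and $\mu$ (not on $G$, $N$, $\Delta$ or the grid).
   Context: Guest graphs are finite, simple and undirected. Write $[\ell]=\{1,\ldots,\ell\}$. For positive integers $\ell_1,\ldots,\ell_d$, the $d$-dimensional $\ell_1\times\cdots\times\ell_d$-grid is the graph with node set $\prod_{i=1}^d[\ell_i]$ in which two nodes are adjacent iff they differ in exactly one coordinate, and there by exactly $1$. Its aspect ratio is $\max_{i,j}\ell_j/\ell_i$. An embedding of a graph $G$ into a graph $H$ is a pair $\langle\phi,\rho\rangle$ where $\phi:V(G)\to V(H)$ is injective and $\rho$ assigns to each edge $(u,v)$ of $G$ the edge set of a path in $H$ connecting $\phi(u)$ and $\phi(v)$. Its edge-congestion is the maximum, over edges $e'$ of $H$, of the number of edges of $G$ whose assigned path contains $e'$. -}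

module Defs where

open import Data.Fin.Base using (Fin; toℕ)
import Data.Fin.Properties as Fin
open import Data.Integer.Base using (+_)
open import Data.List.Base
  using (List; []; _∷_; _++_; length; map; filter; head; last; zip; drop;
         allFin; cartesianProduct; cartesianProductWith)
import Data.List.Extrema
open import Data.List.Extrema.Nat using (max)
open import Data.List.Membership.Propositional using (_∈_)
open import Data.List.Membership.Propositional.Properties
  using (∈-allFin; ∈-cartesianProductWith⁺)
import Data.List.Membership.DecPropositional as DecMembership
open import Data.List.Relation.Unary.All using (All; []; _∷_)
open import Data.List.Relation.Unary.AllPairs using ([]; _∷_)
open import Data.List.Relation.Unary.Any using (here)
open import Data.List.Relation.Unary.Linked using (Linked)
open import Data.List.Relation.Unary.Unique.Propositional using (Unique)
import Data.List.Relation.Unary.Unique.Propositional.Properties as Unique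
open import Data.Maybe.Base using (just)
open import Data.Nat.Base using (ℕ; suc; _≤_; _∸_; ∣_-_∣; NonZero)
import Data.Nat.Properties as ℕ
open import Data.Product.Base using (Σ-syntax; ∃-syntax; _×_; _,_)
import Data.Product.Properties as Product
open import Data.Rational.Base as ℚ using (ℚ; 1ℚ; _/_)
import Data.Rational.Properties as ℚ
open import Data.Sum.Base using (_⊎_)
open import Data.Vec.Base as Vec using (Vec; []; _∷_)
open import Data.Vec.Relation.Unary.All as VecAll using ([]; _∷_)
open import Data.Vec.Relation.Unary.All.Properties using (lookup⁺)
open import Function.Definitions using (Injective)
open import Level using (0ℓ)
open import Relation.Binary.Bundles using (DecTotalOrder)
open import Relation.Binary.Core using (Rel; REL)
open import Relation.Binary.Definitions
  using (Symmetric; Irreflexive; Decidable; DecidableEquality)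
open import Relation.Binary.PropositionalEquality
  using (_≡_; _≢_; refl; sym; trans)
open import Relation.Nullary.Decidable using (Dec; yes; no; _×-dec_; _→-dec_; _⊎-dec_; ¬?)
open import Relation.Nullary.Negation using (¬_)

-- Real numbers as regular Cauchy sequences (Bishop): a sequence (qₙ) denotes
-- the real x with |x - qₙ| ≤ 1/(n+1) for all n.

record ℝ : Set where
  field
    approx  : ℕ → ℚ
    regular : ∀ m n → ℚ.∣ approx m ℚ.- approx n ∣ ℚ.≤ (+ 1 / suc m) ℚ.+ (+ 1 / suc n)

infix 4 _≤ᴿ_

_≤ᴿ_ : ℚ → ℝ → Set
q ≤ᴿ x = ∀ n → q ℚ.≤ ℝ.approx x n ℚ.+ (+ 1 / suc n)

-- Finite simple undirected graphs; `vertices` lists every vertex exactly once.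

record Graph : Set₁ where
  field
    Vertex   : Set
    _≟_      : DecidableEquality Vertex
    vertices : List Vertex
    complete : ∀ v → v ∈ vertices
    unique   : Unique vertices
    Adj      : Rel Vertex 0ℓ
    adj?     : Decidable Adj
    adj-sym  : Symmetric Adj
    irrefl   : Irreflexive _≡_ Adj

open Graph using (Vertex; vertices)

order : Graph → ℕ
order G = length (vertices G)

degree : (G : Graph) → Vertex G → ℕ
degree G v = length (filter (Graph.adj? G v) (vertices G))

maxDegree : Graph → ℕ
maxDegree G = max 0 (map (degree G) (vertices G))

pairs : ∀ {A : Set} → List A → List (A × A)
pairs []       = []
pairs (x ∷ xs) = map (x ,_) xs ++ pairs xs

-- Every undirected edge occurs exactly once, oriented by the order of `vertices`.
edges : (G : Graph) → List (Vertex G × Vertex G)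
edges G = filter (λ (u , v) → Graph.adj? G u v) (pairs (vertices G))

-- Paths are given by their sequences of (distinct) vertices.

record IsPath (G : Graph) (x y : Vertex G) (ws : List (Vertex G)) : Set where
  field
    starts   : head ws ≡ just x
    ends     : last ws ≡ just y
    linked   : Linked (Graph.Adj G) ws
    distinct : Unique ws

steps : ∀ {A : Set} → List A → List (A × A)
steps ws = zip ws (drop 1 ws)

-- The undirected edge {x , y} belongs to the edge set of the path ws.
Traverses : ∀ {A : Set} → A × A → List A → Set
Traverses (x , y) ws = (x , y) ∈ steps ws ⊎ (y , x) ∈ steps ws

traverses? : (G : Graph) (e : Vertex G × Vertex G) (ws : List (Vertex G)) →
             Dec (Traverses e ws)
traverses? G (x , y) ws = ((x , y) ∈? steps ws) ⊎-dec ((y , x) ∈? steps ws)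
  where open DecMembership (Product.≡-dec (Graph._≟_ G) (Graph._≟_ G)) using (_∈?_)

record IsTree (T : Graph) : Set where
  field
    nonempty  : 1 ≤ order T
    connected : ∀ x y → ∃[ ws ] IsPath T x y ws
    -- A cycle is a path on at least three vertices whose ends are adjacent.
    acyclic   : ∀ {x y ws} → IsPath T x y ws → 3 ≤ length ws → ¬ Graph.Adj T y x

record TreeDecomposition (G : Graph) : Set₁ where
  field
    tree         : Graph
    isTree       : IsTree tree
    Bag          : REL (Vertex tree) (Vertex G) 0ℓ
    bag?         : Decidable Bag
    covers-node  : ∀ v → ∃[ x ] Bag x v
    covers-edge  : ∀ {u v} → Graph.Adj G u v → ∃[ x ] (Bag x u × Bag x v)
    -- The tree nodes whose bag contains v induce a connected subgraph.
    bags-connect : ∀ v {x y} → Bag x v → Bag y v →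
                   ∃[ ws ] (IsPath tree x y ws × All (λ z → Bag z v) ws)

  bagSize : Vertex tree → ℕ
  bagSize x = length (filter (bag? x) (vertices G))

  -- For the graph without nodes this is 0 instead of the customary -1.
  width : ℕ
  width = max 0 (map bagSize (vertices tree)) ∸ 1

TreewidthAtMost : Graph → ℕ → Set₁
TreewidthAtMost G t = Σ[ D ∈ TreeDecomposition G ] TreeDecomposition.width D ≤ t

-- The host path of a guest edge is `ρ u v` for its orientation (u , v) in
-- `edges G`; the values of ρ at all other pairs are irrelevant.

record Embedding (G H : Graph) : Set where
  field
    φ           : Vertex G → Vertex H
    φ-injective : Injective _≡_ _≡_ φ
    ρ           : Vertex G → Vertex G → List (Vertex H)
    ρ-path      : ∀ {u v} → (u , v) ∈ edges G → IsPath H (φ u) (φ v) (ρ u v)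

  load : Vertex H × Vertex H → ℕ
  load e = length (filter (λ (u , v) → traverses? H e (ρ u v)) (edges G))

  edgeCongestion : ℕ
  edgeCongestion = max 0 (map load (edges H))

-- A grid node is a heterogeneous vector with i-th coordinate in Fin ℓᵢ, that is
-- {0,…,ℓᵢ-1} in place of {1,…,ℓᵢ}.

Node : ∀ {d} → Vec ℕ d → Set
Node ℓ = VecAll.All Fin ℓ

coord : ∀ {d} {ℓ : Vec ℕ d} → Node ℓ → (i : Fin d) → Fin (Vec.lookup ℓ i)
coord x i = lookup⁺ x i

GridAdj : ∀ {d} {ℓ : Vec ℕ d} → Rel (Node ℓ) 0ℓ
GridAdj x y = ∃[ i ] (∣ toℕ (coord x i) - toℕ (coord y i) ∣ ≡ 1 ×
                      (∀ j → j ≢ i → coord x j ≡ coord y j))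

nodes : ∀ {d} (ℓ : Vec ℕ d) → List (Node ℓ)
nodes []      = [] ∷ []
nodes (k ∷ ℓ) = cartesianProductWith _∷_ (allFin k) (nodes ℓ)

node-≟ : ∀ {d} {ℓ : Vec ℕ d} → DecidableEquality (Node ℓ)
node-≟ []       []       = yes refl
node-≟ (x ∷ xs) (y ∷ ys) with x Fin.≟ y | node-≟ xs ys
... | yes refl | yes refl = yes refl
... | no x≢y   | _        = no λ { refl → x≢y refl }
... | yes _    | no xs≢ys = no λ { refl → xs≢ys refl }

nodes-complete : ∀ {d} {ℓ : Vec ℕ d} (x : Node ℓ) → x ∈ nodes ℓ
nodes-complete []       = here refl
nodes-complete (x ∷ xs) = ∈-cartesianProductWith⁺ _∷_ (∈-allFin x) (nodes-complete xs)

nodes-unique : ∀ {d} (ℓ : Vec ℕ d) → Unique (nodes ℓ)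
nodes-unique []      = [] ∷ []
nodes-unique (k ∷ ℓ) =
  Unique.cartesianProductWith⁺ _∷_ (λ { refl → refl , refl })
    (Unique.allFin⁺ k) (nodes-unique ℓ)

gridAdj? : ∀ {d} {ℓ : Vec ℕ d} → Decidable (GridAdj {ℓ = ℓ})
gridAdj? x y = Fin.any? λ i →
  (∣ toℕ (coord x i) - toℕ (coord y i) ∣ ℕ.≟ 1) ×-dec
  Fin.all? λ j → ¬? (j Fin.≟ i) →-dec (coord x j Fin.≟ coord y j)

gridAdj-sym : ∀ {d} {ℓ : Vec ℕ d} → Symmetric (GridAdj {ℓ = ℓ})
gridAdj-sym {x = x} {y} (i , diff , same) =
  i , trans (ℕ.∣-∣-comm (toℕ (coord y i)) (toℕ (coord x i))) diff ,
  λ j j≢i → sym (same j j≢i)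

gridAdj-irrefl : ∀ {d} {ℓ : Vec ℕ d} → Irreflexive _≡_ (GridAdj {ℓ = ℓ})
gridAdj-irrefl {x = x} refl (i , diff , _)
  with () ← trans (sym (ℕ.∣n-n∣≡0 (toℕ (coord x i)))) diff

Grid : ∀ {d} → Vec ℕ d → Graph
Grid ℓ = record
  { Vertex   = Node ℓ
  ; _≟_      = node-≟
  ; vertices = nodes ℓ
  ; complete = nodes-complete
  ; unique   = nodes-unique ℓ
  ; Adj      = GridAdj
  ; adj?     = gridAdj?
  ; adj-sym  = λ {x} {y} → gridAdj-sym {x = x} {y}
  ; irrefl   = λ {x} {y} → gridAdj-irrefl {x = x} {y}
  }

-- The ratios with i = j equal 1, so the default value 1 does not affect the
-- maximum when d ≥ 1.
aspectRatio : ∀ {d} (ℓ : Vec ℕ d) → (∀ i → NonZero (Vec.lookup ℓ i)) → ℚ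
aspectRatio {d} ℓ ℓ≢0 = ℚmax 1ℚ
  (map (λ (i , j) → _/_ (+ Vec.lookup ℓ j) (Vec.lookup ℓ i) {{ℓ≢0 i}})
       (cartesianProduct (allFin d) (allFin d)))
  where open Data.List.Extrema (DecTotalOrder.totalOrder ℚ.≤-decTotalOrder) using () renaming (max to ℚmax)

{-# OPTIONS --safe #-}

-- A Hamiltonian path through all dimensions but the first reduces everything to a
-- two-dimensional host whose sides are polynomially related.  The host is halved recursively
-- across its longer side.  A vertex set S with m vertices and treewidth at most t has, by balanced
-- separators, a linear order of cutwidth O(t Δ log m), and a window of that order can be chosen
-- that also splits the edges leaving S evenly; so a region of level n (about 2^n nodes) is left by
-- only O(t Δ n) edges.  Each of them gets a port in the region, and its route climbs from port to
-- port, along a row and a column.  Ports of level n use only rows and columns whose 2-adic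
-- valuation is ⌊n / p⌋; there are enough of them since the sides of the region are exponential
-- in n, and every row or column carries ports of at most p levels, at most Δ per region.

module Submission where

open import Defs
open import Data.Bool.Base using (true; false)
open import Data.Fin.Base using (Fin; zero; suc; toℕ; fromℕ<)
open import Data.Fin.Properties using (toℕ-fromℕ<)
open import Data.Integer.Base as ℤ using (-[1+_])
import Data.Integer.Properties as ℤ
open import Data.List.Base as List
  using (List; []; _∷_; _++_; length; map; filter; head; last; take; drop; reverse; tabulate;
         allFin; cartesianProduct; cartesianProductWith; InitLast; initLast; _∷ʳ′_)
import Data.List.Extrema
open import Data.List.Extrema.Nat using (xs≤max; max≤v⁺)
open import Data.List.Membership.Propositional using (_∈_; _∉_; find; lose)
open import Data.List.Membership.Propositional.Properties
import Data.List.Membership.DecPropositional as DecMembership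
open import Data.List.Properties hiding (sum-++)
open import Data.List.Relation.Binary.Permutation.Propositional
  using (_↭_; ↭-refl; ↭-sym; ↭-trans; ↭-reflexive; ↭⇒↭ₛ; prep)
open import Data.List.Relation.Binary.Permutation.Propositional.Properties
  using (↭-length; ∈-resp-↭; map⁺; ++-comm; ++⁺; ++⁺ˡ; ++⁺ʳ; shifts; shift; ↭-reverse)
import Data.List.Relation.Binary.Permutation.Setoid.Properties as PermSetoid
open import Data.List.Relation.Unary.All as All using (All; []; _∷_)
import Data.List.Relation.Unary.All.Properties as Allₚ
open import Data.List.Relation.Unary.AllPairs using ([]; _∷_)
open import Data.List.Relation.Unary.Any using (here; there; any?)
open import Data.List.Relation.Unary.Linked as Linked using (Linked; []; [-]; _∷_)
import Data.List.Relation.Unary.Linked.Properties as Linkedₚ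
open import Data.List.Relation.Unary.Unique.Propositional using (Unique)
import Data.List.Relation.Unary.Unique.Propositional.Properties as Unique
open import Data.Maybe.Base using (just)
open import Data.Maybe.Relation.Binary.Connected using (Connected; just; just-nothing; nothing)
open import Data.Nat.Base
open import Data.Nat.DivMod
open import Data.Nat.ListAction using (sum)
open import Data.Nat.ListAction.Properties using (sum-++; sum-↭)
open import Data.Nat.Properties hiding (_≟_)
import Data.Nat.Properties as ℕ
open import Data.Nat.Tactic.RingSolver using (solve-∀)
open import Data.Product.Base using (Σ-syntax; ∃-syntax; _×_; _,_; proj₁; proj₂; swap)
import Data.Product.Properties as Product
open import Data.Rational.Base as ℚ using (ℚ; 1ℚ; mkℚ) renaming (_/_ to _/ℚ_)
import Data.Rational.Properties as ℚ
open import Data.Rational.Unnormalised.Base using (mkℚᵘ)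
import Data.Rational.Unnormalised.Properties as ℚᵘ
open import Data.Sum.Base using (_⊎_; inj₁; inj₂; [_,_]′)
open import Data.Vec.Base using (Vec; []; _∷_; lookup)
open import Data.Vec.Relation.Unary.All using ([]; _∷_)
open import Function.Base using (_∘_; id; case_of_)
open import Relation.Binary.Bundles using (DecTotalOrder)
open import Relation.Binary.Construct.Closure.ReflexiveTransitive as Star using (Star; ε; _◅_; _◅◅_)
open import Relation.Binary.Definitions using (DecidableEquality)
open import Relation.Binary.PropositionalEquality hiding ([_])
open import Relation.Nullary.Decidable using (Dec; yes; no; does; ¬?; _×-dec_; map′)
open import Relation.Nullary.Negation using (¬_; contradiction)
import Relation.Unary as U

-- The obstacle is to keep every bound free of the total number of levels. If a part could inherit
-- all edges that leave its parent, the cut edges of all ancestors would add up. A part inherits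
-- only about two thirds of them, so older cuts fade geometrically, and a bound linear in the level
-- of the region itself survives, whatever the size of the grid. The plane that remains after the
-- reduction need not be close to a square: its sides may be `a` and about `a ^ (d - 1)`. What is
-- preserved under halving the longer side is only `n ≤ q * suc i` for the exponent `i` of either
-- side. Taking `p = 2 * q` lets the spacing of the reserved lines consume at most about the square
-- root of a side; the other half of the exponent leaves room for the linear number of ports as soon
-- as `n` reaches a constant `n₀`. Regions of smaller level have bounded area and need no care. A
-- cut edge is handled as two opposite darts, one leaving each part. Each part can then be laid out
-- without knowledge of the other, and only the ports have to be joined.

-- Duplicate-free lists and weights

Unique-resp-↭ : ∀ {A : Set} {xs ys : List A} → xs ↭ ys → Unique xs → Unique ys
Unique-resp-↭ {A} p = PermSetoid.Unique-resp-↭ (setoid A) (↭⇒↭ₛ p)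

Unique-++⁻ : ∀ {A : Set} (xs : List A) {ys} → Unique (xs ++ ys) →
             Unique xs × Unique ys × (∀ {x} → x ∈ xs → x ∉ ys)
Unique-++⁻ []       u        = [] , u , λ ()
Unique-++⁻ (x ∷ xs) (x∉ ∷ u) =
  let uxs , uys , dis = Unique-++⁻ xs u in
  Allₚ.++⁻ˡ xs x∉ ∷ uxs , uys ,
  λ { (here refl) y∈ → All.lookup (Allₚ.++⁻ʳ xs x∉) y∈ refl ; (there z∈) → dis z∈ }

unique-⊆-length : ∀ {A : Set} {xs ys : List A} → Unique xs →
                  (∀ {x} → x ∈ xs → x ∈ ys) → length xs ≤ length ys
unique-⊆-length {xs = []} _ _ = z≤n
unique-⊆-length {xs = x ∷ xs} (x∉ ∷ u) sub with ∈-∃++ (sub (here refl))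
... | as , bs , refl = begin
  suc (length xs)          ≤⟨ s≤s (unique-⊆-length u sub′) ⟩
  suc (length (as ++ bs))  ≡⟨ ↭-length (shift x as bs) ⟨
  length (as ++ x ∷ bs)    ∎
  where
  open ≤-Reasoning
  sub′ : ∀ {y} → y ∈ xs → y ∈ as ++ bs
  sub′ y∈ with ∈-resp-↭ (shift x as bs) (sub (there y∈))
  ... | here refl = contradiction refl (All.lookup x∉ y∈)
  ... | there p   = p

weight : ∀ {A : Set} → (A → ℕ) → List A → ℕ
weight f xs = sum (map f xs)

module _ {A : Set} (f : A → ℕ) where

  weight-++ : ∀ xs ys → weight f (xs ++ ys) ≡ weight f xs + weight f ys
  weight-++ xs ys = trans (cong sum (map-++ f xs ys)) (sum-++ (map f xs) (map f ys))

  weight-↭ : ∀ {xs ys} → xs ↭ ys → weight f xs ≡ weight f ys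
  weight-↭ p = sum-↭ (map⁺ f p)

  weight≤ : ∀ {k} xs → (∀ x → f x ≤ k) → weight f xs ≤ length xs * k
  weight≤ []       b = z≤n
  weight≤ (x ∷ xs) b = +-mono-≤ (b x) (weight≤ xs b)

weight-+ : ∀ {A : Set} {f g h : A → ℕ} xs → (∀ x → f x ≡ g x + h x) →
           weight f xs ≡ weight g xs + weight h xs
weight-+ []       eq = refl
weight-+ {f = f} {g} {h} (x ∷ xs) eq rewrite eq x | weight-+ {f = f} {g} {h} xs eq =
  lemma (g x) (h x) (weight g xs) (weight h xs)
  where
  lemma : ∀ a b c d → a + b + (c + d) ≡ a + c + (b + d)
  lemma = solve-∀

weight-0 : ∀ {A : Set} {f : A → ℕ} xs → (∀ {x} → x ∈ xs → f x ≡ 0) → weight f xs ≡ 0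
weight-0 []       z = refl
weight-0 (x ∷ xs) z = cong₂ _+_ (z (here refl)) (weight-0 xs (z ∘ there))

∈-filter-partition : ∀ {A : Set} {P : A → Set} (P? : U.Decidable P) (xs : List A) →
                     filter P? xs ++ filter (¬? ∘ P?) xs ↭ xs
∈-filter-partition P? [] = ↭-refl
∈-filter-partition P? (x ∷ xs) with does (P? x)
... | true  = prep x (∈-filter-partition P? xs)
... | false = ↭-trans (shift x (filter P? xs) _) (prep x (∈-filter-partition P? xs))

-- Counting edges between vertex lists

module Count (G : Graph) where

  open Graph G using (Vertex; vertices; Adj; adj?; adj-sym)

  Δ : ℕ
  Δ = maxDegree G

  neighbours : Vertex → List Vertex → ℕ
  neighbours v Q = length (filter (adj? v) Q)

  -- For disjoint lists without repetitions this is the number of edges between them; `e S S` counts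
  -- each edge inside `S` twice, once for each orientation.
  e : List Vertex → List Vertex → ℕ
  e P Q = weight (λ v → neighbours v Q) P

  neighbours-++ : ∀ v Q R → neighbours v (Q ++ R) ≡ neighbours v Q + neighbours v R
  neighbours-++ v Q R = trans (cong length (filter-++ (adj? v) Q R)) (length-++ (filter (adj? v) Q))

  neighbours≤Δ : ∀ v {Q} → Unique Q → neighbours v Q ≤ Δ
  neighbours≤Δ v {Q} u = ≤-trans
    (unique-⊆-length (Unique.filter⁺ (adj? v) u)
      (λ x∈ → ∈-filter⁺ (adj? v) (Graph.complete G _) (proj₂ (∈-filter⁻ (adj? v) {xs = Q} x∈))))
    (All.lookup (xs≤max 0 (map (degree G) vertices)) (∈-map⁺ (degree G) (Graph.complete G v)))

  e-++ˡ : ∀ P P′ Q → e (P ++ P′) Q ≡ e P Q + e P′ Q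
  e-++ˡ P P′ Q = weight-++ _ P P′

  e-++ʳ : ∀ P Q Q′ → e P (Q ++ Q′) ≡ e P Q + e P Q′
  e-++ʳ P Q Q′ = weight-+ P λ v → neighbours-++ v Q Q′

  e-[]ʳ : ∀ P → e P [] ≡ 0
  e-[]ʳ P = weight-0 P λ _ → refl

  neighbours-swap : ∀ u v → neighbours u (v ∷ []) ≡ neighbours v (u ∷ [])
  neighbours-swap u v with adj? u v | adj? v u
  ... | yes _ | yes _ = refl
  ... | no _  | no _  = refl
  ... | yes p | no q  = contradiction (adj-sym p) q
  ... | no p  | yes q = contradiction (adj-sym q) p

  e-[-]ʳ : ∀ P v → e P (v ∷ []) ≡ neighbours v P
  e-[-]ʳ []      v = refl
  e-[-]ʳ (u ∷ P) v = trans (cong₂ _+_ (neighbours-swap u v) (e-[-]ʳ P v))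
                           (sym (neighbours-++ v (u ∷ []) P))

  e-sym : ∀ P Q → e P Q ≡ e Q P
  e-sym P []      = e-[]ʳ P
  e-sym P (v ∷ Q) = trans (e-++ʳ P (v ∷ []) Q) (cong₂ _+_ (e-[-]ʳ P v) (e-sym P Q))

  e-↭ˡ : ∀ {P P′} Q → P ↭ P′ → e P Q ≡ e P′ Q
  e-↭ˡ Q p = weight-↭ _ p

  e≤ˡ : ∀ P {Q} → Unique Q → e P Q ≤ length P * Δ
  e≤ˡ P u = weight≤ _ P λ v → neighbours≤Δ v u

  e≤ʳ : ∀ {P} Q → Unique P → e P Q ≤ length Q * Δ
  e≤ʳ {P} Q u = subst (_≤ length Q * Δ) (e-sym Q P) (e≤ˡ Q u)

  e-0 : ∀ P Q → (∀ {u v} → u ∈ P → v ∈ Q → ¬ Adj u v) → e P Q ≡ 0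
  e-0 P Q none = weight-0 P λ {u} u∈ → cong length (filter-none (adj? u) (All.tabulate λ v∈ → none u∈ v∈))

-- Balanced separators

last-∷ʳ : ∀ {A : Set} (xs : List A) x → last (xs ++ x ∷ []) ≡ just x
last-∷ʳ []           x = refl
last-∷ʳ (y ∷ [])     x = refl
last-∷ʳ (y ∷ z ∷ xs) x = last-∷ʳ (z ∷ xs) x

Linked-++⁻ˡ : ∀ {A : Set} {R : A → A → Set} xs {ys} → Linked R (xs ++ ys) → Linked R xs
Linked-++⁻ˡ []           l       = []
Linked-++⁻ˡ (x ∷ [])     l       = [-]
Linked-++⁻ˡ (x ∷ y ∷ xs) (r ∷ l) = r ∷ Linked-++⁻ˡ (y ∷ xs) l

module Leaves (T : Graph) (isTree : IsTree T) where

  open Graph T using (Vertex; _≟_; Adj; adj?; adj-sym; irrefl)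
  open IsTree isTree
  open DecMembership _≟_ using (_∈?_)

  Convex : List Vertex → Set
  Convex A = ∀ {x y ws} → IsPath T x y ws → x ∈ A → y ∈ A → All (_∈ A) ws

  record Leaf (A : List Vertex) : Set where
    field
      leaf parent : Vertex
      leaf∈       : leaf ∈ A
      parent∈     : parent ∈ A
      parent≢     : parent ≢ leaf
      only-parent : ∀ {z} → z ∈ A → Adj leaf z → z ≡ parent

  -- An end of a maximal path has only one neighbour, since any other one would close a cycle.
  end-of-maximal-path : ∀ (A : List Vertex) k x p rest → length A ≤ k + length (x ∷ p ∷ rest) →
    Linked Adj (x ∷ p ∷ rest) → Unique (x ∷ p ∷ rest) → All (_∈ A) (x ∷ p ∷ rest) → Leaf A
  end-of-maximal-path A k x p rest len li un@((x≢p ∷ _) ∷ _) al@(x∈ ∷ p∈ ∷ _)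
    with any? (λ z → adj? x z ×-dec ¬? (z ∈? (x ∷ p ∷ rest))) A
  ... | no none = record
    { leaf = x ; parent = p ; leaf∈ = x∈ ; parent∈ = p∈ ; parent≢ = x≢p ∘ sym ; only-parent = only }
    where
    only : ∀ {z} → z ∈ A → Adj x z → z ≡ p
    only {z} z∈A xz with z ∈? (x ∷ p ∷ rest)
    ... | no z∉                     = contradiction (lose z∈A (xz , z∉)) none
    ... | yes (here refl)           = contradiction xz (irrefl refl)
    ... | yes (there (here refl))   = refl
    ... | yes (there (there z∈)) with ∈-∃++ z∈
    ...   | as , bs , refl = contradiction (adj-sym xz) (acyclic path (s≤s (s≤s (nonempty-length as))))
      where
      nonempty-length : ∀ as → 1 ≤ length (as ++ z ∷ [])
      nonempty-length []      = s≤s z≤n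
      nonempty-length (_ ∷ _) = s≤s z≤n
      cycle : List Vertex
      cycle = x ∷ p ∷ as ++ z ∷ []
      split : cycle ++ bs ≡ x ∷ p ∷ as ++ z ∷ bs
      split = cong (λ ys → x ∷ p ∷ ys) (++-assoc as (z ∷ []) bs)
      path : IsPath T x z cycle
      path = record
        { starts   = refl
        ; ends     = last-∷ʳ (x ∷ p ∷ as) z
        ; linked   = Linked-++⁻ˡ cycle (subst (Linked Adj) (sym split) li)
        ; distinct = proj₁ (Unique-++⁻ cycle (subst Unique (sym split) un))
        }
  ... | yes w with find w
  ...   | z , z∈A , xz , z∉ with k
  ...     | zero  = contradiction
    (≤-trans (unique-⊆-length (Allₚ.¬Any⇒All¬ _ z∉ ∷ un) (All.lookup (z∈A ∷ al))) len)
    1+n≰n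
  ...     | suc k = end-of-maximal-path A k z x (p ∷ rest)
    (subst (length A ≤_) (sym (+-suc k _)) len)
    (adj-sym xz ∷ li) (Allₚ.¬Any⇒All¬ _ z∉ ∷ un) (z∈A ∷ al)

  path-step : ∀ {x y ws} → IsPath T x y ws → x ≢ y → ∃[ p ] (p ∈ ws × Adj x p)
  path-step {ws = []} record { starts = () }
  path-step {ws = a ∷ []} record { starts = refl ; ends = refl } x≢y = contradiction refl x≢y
  path-step {ws = a ∷ p ∷ ws} record { starts = refl ; linked = xp ∷ _ } _ = p , there (here refl) , xp

  exists-leaf : ∀ {A x y} → Convex A → x ∈ A → y ∈ A → x ≢ y → Leaf A
  exists-leaf {A} {x} {y} convex x∈ y∈ x≢y =
    let ws , path = connected x y
        p , p∈ws , xp = path-step path x≢y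
        p∈ = All.lookup (convex path x∈ y∈) p∈ws
    in end-of-maximal-path A (length A) x p [] (m≤m+n _ _)
         (xp ∷ [-]) (((λ x≡p → irrefl x≡p xp) ∷ []) ∷ [] ∷ []) (x∈ ∷ p∈ ∷ [])

  interior : ∀ {x z} y ws → Linked Adj (y ∷ ws) → Unique (y ∷ ws) → last (y ∷ ws) ≡ just z →
             x ∈ ws → x ≢ z →
             ∃[ a ] ∃[ b ] (a ∈ y ∷ ws × b ∈ y ∷ ws × a ≢ b × Adj x a × Adj x b)
  interior y (x ∷ []) _ _ refl (here refl) x≢z = contradiction refl x≢z
  interior y (x ∷ b ∷ _) (yx ∷ xb ∷ _) ((_ ∷ y≢b ∷ _) ∷ _) _ (here refl) _ =
    y , b , here refl , there (there (here refl)) , y≢b , adj-sym yx , xb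
  interior y (w ∷ ws) (_ ∷ li) (_ ∷ un) ends (there x∈) x≢z =
    let a , b , a∈ , b∈ , rest = interior w ws li un ends x∈ x≢z
    in a , b , there a∈ , there b∈ , rest

  remove : Vertex → List Vertex → List Vertex
  remove x = filter (λ z → ¬? (z ≟ x))

  -- A path between other nodes avoids the leaf: as an inner node of the path the leaf would have
  -- two different neighbours in `A`, against `only-parent`.
  convex-remove : ∀ {A} → Convex A → (l : Leaf A) → Convex (remove (Leaf.leaf l) A)
  convex-remove {A} convex l {ws = ws} path y∈ z∈ = All.tabulate λ {w} w∈ →
    ∈-filter⁺ _ (All.lookup all∈ w∈) λ w≡x → x∉ path y≢x z≢x all∈ (subst (_∈ _) w≡x w∈)
    where
    open Leaf l
    y≢x = proj₂ (∈-filter⁻ (λ z → ¬? (z ≟ leaf)) {xs = A} y∈)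
    z≢x = proj₂ (∈-filter⁻ (λ z → ¬? (z ≟ leaf)) {xs = A} z∈)
    all∈ : All (_∈ A) ws
    all∈ = convex path (proj₁ (∈-filter⁻ (λ z → ¬? (z ≟ leaf)) {xs = A} y∈))
                       (proj₁ (∈-filter⁻ (λ z → ¬? (z ≟ leaf)) {xs = A} z∈))
    x∉ : ∀ {y z ws} → IsPath T y z ws → y ≢ leaf → z ≢ leaf → All (_∈ A) ws → leaf ∉ ws
    x∉ record { starts = refl } y≢ _ _ (here refl) = y≢ refl
    x∉ {ws = y ∷ ws} record { starts = refl ; ends = ends ; linked = li ; distinct = un } y≢ z≢ all (there x∈) =
      let a , b , a∈ , b∈ , a≢b , xa , xb = interior y ws li un ends x∈ (z≢ ∘ sym)
      in a≢b (trans (only-parent (All.lookup all a∈) xa) (sym (only-parent (All.lookup all b∈) xb)))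

  remove-< : ∀ {x A} → x ∈ A → length (remove x A) < length A
  remove-< {x} {A} x∈ = filter-notAll (λ z → ¬? (z ≟ x)) A (lose x∈ λ ¬x → ¬x refl)

-- The sides are measured against an arbitrary list `S`, because separators are later taken inside
-- the vertex sets of regions and again inside the sides of earlier separators.
record Separation (G : Graph) (τ : ℕ) (S : List (Graph.Vertex G)) : Set where
  field
    left middle right : List (Graph.Vertex G)
    perm     : left ++ middle ++ right ↭ S
    middle≤  : length middle ≤ τ
    left≤    : 3 * length left ≤ 2 * length S
    right≤   : 3 * length right ≤ 2 * length S
    separate : ∀ {u v} → u ∈ left → v ∈ right → ¬ Graph.Adj G u v

module Separator (G : Graph) (D : TreeDecomposition G) where

  open TreeDecomposition D
  open Graph G using (Vertex; vertices; Adj; _≟_)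
  open Graph tree using () renaming (Vertex to TreeNode; vertices to nodesᵀ; _≟_ to _≟ᵀ_; Adj to Adjᵀ)
  open DecMembership _≟_ using (_∈?_)
  open Leaves tree isTree

  τ : ℕ
  τ = suc width

  bagSize≤ : ∀ x → bagSize x ≤ τ
  bagSize≤ x = ≤-trans
    (All.lookup (xs≤max 0 (map bagSize nodesᵀ)) (∈-map⁺ bagSize (Graph.complete tree x)))
    (≤-trans (m≤n+m∸n _ 1) ≤-refl)

  module _ (S : List Vertex) (uniqueS : Unique S) (nonemptyS : 1 ≤ length S) where

    inside outside : List Vertex → List Vertex
    inside U = filter (_∈? U) S
    outside U = filter (λ v → ¬? (v ∈? U)) S

    count : List Vertex → ℕ
    count U = length (inside U)

    count-++ : ∀ U W → count (U ++ W) ≤ count U + count W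
    count-++ U W = subst (count (U ++ W) ≤_) (length-++ (inside U))
      (unique-⊆-length (Unique.filter⁺ (_∈? (U ++ W)) uniqueS) λ {x} x∈ →
        let x∈S , x∈UW = ∈-filter⁻ (_∈? (U ++ W)) {xs = S} x∈
        in [ (λ u → ∈-++⁺ˡ (∈-filter⁺ (_∈? U) x∈S u)) ,
             (λ w → ∈-++⁺ʳ (inside U) (∈-filter⁺ (_∈? W) x∈S w)) ]′ (∈-++⁻ U x∈UW))

    -- U is the union of the bags of a subtree that is attached to the rest of the tree at x.
    separation-at : ∀ x U → (∀ {v} → Bag x v → v ∈ U) → length S < 3 * count U →
      3 * length (filter (λ v → ¬? (bag? x v)) (inside U)) ≤ 2 * length S →
      (∀ {u w} → u ∈ U → ¬ Bag x u → w ∉ U → ¬ Adj u w) → Separation G τ S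
    separation-at x U bag⊆U large left≤ sep = record
      { left = left
      ; middle = middle
      ; right = outside U
      ; perm = ↭-trans (↭-reflexive (sym (++-assoc left middle _)))
          (↭-trans (++⁺ʳ _ (↭-trans (++-comm left middle) (∈-filter-partition (bag? x) (inside U))))
            (∈-filter-partition (_∈? U) S))
      ; middle≤ = ≤-trans
          (unique-⊆-length (Unique.filter⁺ (bag? x) (Unique.filter⁺ (_∈? U) uniqueS))
            λ v∈ → ∈-filter⁺ (bag? x) (Graph.complete G _) (proj₂ (∈-filter⁻ (bag? x) {xs = inside U} v∈)))
          (bagSize≤ x)
      ; left≤ = left≤
      ; right≤ = right≤
      ; separate = λ u∈ v∈ →
          let u∈′ , ¬bag = ∈-filter⁻ (λ v → ¬? (bag? x v)) {xs = inside U} u∈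
          in sep (proj₂ (∈-filter⁻ (_∈? U) {xs = S} u∈′)) ¬bag
                 (proj₂ (∈-filter⁻ (λ v → ¬? (v ∈? U)) {xs = S} v∈))
      }
      where
      left   = filter (λ v → ¬? (bag? x v)) (inside U)
      middle = filter (bag? x) (inside U)
      total : count U + length (outside U) ≡ length S
      total = trans (sym (length-++ (inside U))) (↭-length (∈-filter-partition (_∈? U) S))
      right≤ : 3 * length (outside U) ≤ 2 * length S
      right≤ = +-cancelˡ-≤ (length S) _ _ (begin
        length S + 3 * length (outside U)      ≤⟨ +-monoˡ-≤ _ (<⇒≤ large) ⟩
        3 * count U + 3 * length (outside U)   ≡⟨ *-distribˡ-+ 3 (count U) _ ⟨
        3 * (count U + length (outside U))     ≡⟨ cong (3 *_) total ⟩
        3 * length S                           ∎)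
        where open ≤-Reasoning

    -- A state in the pruning of the decomposition tree: `A` holds the surviving nodes, which form a
    -- subtree, and `U z` collects the bags of all nodes merged into `z`. By `interface`, whatever a
    -- cluster shares with another one already lies in the bag of its surviving node, so this bag
    -- cuts the cluster off.
    record Clustering (A : List TreeNode) (U : TreeNode → List Vertex) : Set where
      field
        convex    : Convex A
        root      : ∃[ r ] r ∈ A
        covering  : ∀ y → ∃[ z ] (z ∈ A × (∀ {v} → Bag y v → v ∈ U z))
        interface : ∀ {z z′ v} → z ∈ A → z′ ∈ A → z ≢ z′ → v ∈ U z → v ∈ U z′ → Bag z v
        bag⊆      : ∀ {z v} → Bag z v → v ∈ U z
        small     : ∀ {z} → z ∈ A → 3 * count (U z) ≤ length S

    -- Leaves are merged into their parents until a cluster exceeds a third of `S`. Made of two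
    -- clusters of at most a third each, it has at most two thirds, and the bag of the parent
    -- separates it. This happens before a single node is left, since its cluster would contain all
    -- of the nonempty `S`. The number `k` bounds the remaining merges.
    separate-clusters : ∀ k {A U} → length A ≤ k → Clustering A U → Separation G τ S
    separate-clusters zero {A} len c with Clustering.root c
    separate-clusters zero {_ ∷ _} () c | _
    separate-clusters (suc k) {A} {U} len c with Clustering.root c
    ... | r , r∈ with any? (λ z → ¬? (z ≟ᵀ r)) A
    ... | no all-r = contradiction nonemptyS (<⇒≱ (s≤s (+-cancelʳ-≤ (length S) _ _ (begin
        length S + length S           ≤⟨ m≤m+n _ (length S + 0) ⟩
        length S + length S + (length S + 0) ≡⟨ +-assoc (length S) _ _ ⟩
        3 * length S                  ≡⟨ cong (λ xs → 3 * length xs) (filter-all (_∈? U r) all-in) ⟨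
        3 * count (U r)               ≤⟨ small r∈ ⟩
        length S                      ∎))))
      where
      open ≤-Reasoning
      open Clustering c
      all-in : All (_∈ U r) S
      all-in = All.tabulate λ {v} _ → case covers-node v of λ (y , b) → case covering y of λ (z , z∈ , sub) →
        case z ≟ᵀ r of λ { (yes refl) → sub b ; (no z≢) → contradiction (lose z∈ z≢) all-r }
    ... | yes other with find other
    ...   | q , q∈ , q≢r = merge
      where
      open Clustering c
      ℓ : Leaf A
      ℓ = exists-leaf convex r∈ q∈ (q≢r ∘ sym)
      open Leaf ℓ renaming (leaf to x; parent to p; leaf∈ to x∈; parent∈ to p∈; parent≢ to p≢x)
      merged : List Vertex
      merged = U p ++ U x
      U′ : TreeNode → List Vertex
      U′ z with z ≟ᵀ p
      ... | yes _ = merged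
      ... | no _  = U z

      -- By `interface` both end bags contain `v`, so `bags-connect` yields a path through bags with
      -- `v`. By convexity it stays in `A`, hence it leaves the leaf `x` through its parent `p`.
      shared-with-leaf : ∀ {z v} → z ∈ A → z ≢ x → v ∈ U x → v ∈ U z → Bag p v
      shared-with-leaf {z} {v} z∈ z≢x v∈x v∈z =
        let ws , path , all = bags-connect v (interface x∈ z∈ (z≢x ∘ sym) v∈x v∈z)
                                             (interface z∈ x∈ z≢x v∈z v∈x)
            y , y∈ , xy = path-step path (z≢x ∘ sym)
        in subst (λ y → Bag y v) (only-parent (All.lookup (convex path x∈ z∈) y∈) xy) (All.lookup all y∈)

      shared : ∀ {z v} → z ∈ A → z ≢ x → z ≢ p → v ∈ merged → v ∈ U z → Bag p v
      shared z∈ z≢x z≢p v∈ v∈z =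
        [ (λ v∈p → interface p∈ z∈ (z≢p ∘ sym) v∈p v∈z) , (λ v∈x → shared-with-leaf z∈ z≢x v∈x v∈z) ]′
        (∈-++⁻ (U p) v∈)

      count-merged : 3 * count merged ≤ 2 * length S
      count-merged = begin
        3 * count merged                    ≤⟨ *-monoʳ-≤ 3 (count-++ (U p) (U x)) ⟩
        3 * (count (U p) + count (U x))     ≡⟨ *-distribˡ-+ 3 (count (U p)) _ ⟩
        3 * count (U p) + 3 * count (U x)   ≤⟨ +-mono-≤ (small p∈) (≤-trans (small x∈) (m≤m+n _ 0)) ⟩
        2 * length S                        ∎
        where open ≤-Reasoning

      -- The bag that contains the edge lies in some cluster. As `w` is not in `merged`, this is
      -- neither the cluster of `p` nor that of `x`, so `u` is shared with a third cluster and must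
      -- lie in the bag of `p`.
      no-edge : ∀ {u w} → u ∈ merged → ¬ Bag p u → w ∉ merged → ¬ Adj u w
      no-edge {u} {w} u∈ ¬b w∉ uw with covers-edge uw
      ... | y , bu , bw with covering y
      ...   | z , z∈ , sub with z ≟ᵀ p | z ≟ᵀ x
      ...     | yes refl | _        = w∉ (∈-++⁺ˡ (sub bw))
      ...     | no _     | yes refl = w∉ (∈-++⁺ʳ (U p) (sub bw))
      ...     | no z≢p   | no z≢x   = ¬b (shared z∈ z≢x z≢p u∈ (sub bu))

      A′ : List TreeNode
      A′ = remove x A

      ∈A′⁻ : ∀ {z} → z ∈ A′ → z ∈ A × z ≢ x
      ∈A′⁻ = ∈-filter⁻ (λ z → ¬? (z ≟ᵀ x)) {xs = A}

      ∈A′⁺ : ∀ {z} → z ∈ A → z ≢ x → z ∈ A′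
      ∈A′⁺ = ∈-filter⁺ (λ z → ¬? (z ≟ᵀ x))

      U⊆U′ : ∀ {z v} → v ∈ U z → v ∈ U′ z
      U⊆U′ {z} v∈ with z ≟ᵀ p
      ... | yes refl = ∈-++⁺ˡ v∈
      ... | no _     = v∈

      merged⊆ : ∀ {v} → v ∈ merged → v ∈ U′ p
      merged⊆ v∈ with p ≟ᵀ p
      ... | yes _ = v∈
      ... | no p≢ = contradiction refl p≢

      interface′ : ∀ {z z′ v} → z ∈ A′ → z′ ∈ A′ → z ≢ z′ → v ∈ U′ z → v ∈ U′ z′ → Bag z v
      interface′ {z} {z′} z∈ z′∈ z≢z′ v∈ v∈′ with z ≟ᵀ p | z′ ≟ᵀ p
      ... | yes refl | yes refl = contradiction refl z≢z′
      ... | yes refl | no z′≢p  = shared (proj₁ (∈A′⁻ z′∈)) (proj₂ (∈A′⁻ z′∈)) z′≢p v∈ v∈′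
      ... | no z≢p   | no z′≢p  = interface (proj₁ (∈A′⁻ z∈)) (proj₁ (∈A′⁻ z′∈)) z≢z′ v∈ v∈′
      ... | no z≢p   | yes refl =
        [ (λ v∈p → interface (proj₁ (∈A′⁻ z∈)) p∈ z≢p v∈ v∈p) ,
          (λ v∈x → interface (proj₁ (∈A′⁻ z∈)) x∈ (proj₂ (∈A′⁻ z∈)) v∈ v∈x) ]′ (∈-++⁻ (U p) v∈′)

      covering′ : ∀ y → ∃[ z ] (z ∈ A′ × (∀ {v} → Bag y v → v ∈ U′ z))
      covering′ y with covering y
      ... | z , z∈ , sub with z ≟ᵀ x
      ...   | yes refl = p , ∈A′⁺ p∈ p≢x , λ b → merged⊆ (∈-++⁺ʳ (U p) (sub b))
      ...   | no z≢x   = z , ∈A′⁺ z∈ z≢x , λ b → U⊆U′ (sub b)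

      merge : Separation G τ S
      merge with length S <? 3 * count merged
      ... | yes large = separation-at p merged (λ b → ∈-++⁺ˡ (bag⊆ b)) large
        (≤-trans (*-monoʳ-≤ 3 (length-filter _ (inside merged))) count-merged) no-edge
      ... | no ¬large = separate-clusters k (s≤s⁻¹ (≤-trans (remove-< x∈) len)) record
        { convex    = convex-remove convex ℓ
        ; root      = p , ∈A′⁺ p∈ p≢x
        ; covering  = covering′
        ; interface = interface′
        ; bag⊆      = λ b → U⊆U′ (bag⊆ b)
        ; small     = small′
        }
        where
        small′ : ∀ {z} → z ∈ A′ → 3 * count (U′ z) ≤ length S
        small′ {z} z∈ with z ≟ᵀ p
        ... | yes _ = ≮⇒≥ ¬large
        ... | no _  = small (proj₁ (∈A′⁻ z∈))

    bagList : TreeNode → List Vertex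
    bagList x = filter (bag? x) vertices

    ∈bagList⁺ : ∀ {x v} → Bag x v → v ∈ bagList x
    ∈bagList⁺ {x} b = ∈-filter⁺ (bag? x) (Graph.complete G _) b

    ∈bagList⁻ : ∀ {x v} → v ∈ bagList x → Bag x v
    ∈bagList⁻ {x} v∈ = proj₂ (∈-filter⁻ (bag? x) {xs = vertices} v∈)

    -- A bag with more than a third of `S` is a separator by itself, with nothing on the left.
    -- Otherwise the merging can start with every node as its own cluster, all of them small.
    separation : Separation G τ S
    separation with any? (λ x → length S <? 3 * count (bagList x)) nodesᵀ
    ... | yes large with find large
    ...   | x , _ , large-x = separation-at x (bagList x) ∈bagList⁺ large-x
      (subst (λ xs → 3 * length xs ≤ 2 * length S)
        (sym (filter-none (λ v → ¬? (bag? x v)) {xs = inside (bagList x)}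
          (All.tabulate λ v∈ ¬b → ¬b (∈bagList⁻ (proj₂ (∈-filter⁻ (_∈? bagList x) {xs = S} v∈))))))
        z≤n)
      (λ u∈ ¬b _ _ → ¬b (∈bagList⁻ u∈))
    separation | no none = separate-clusters (length nodesᵀ) {nodesᵀ} {bagList} ≤-refl record
      { convex    = λ _ _ _ → All.tabulate λ _ → Graph.complete tree _
      ; root      = root
      ; covering  = λ y → y , Graph.complete tree y , ∈bagList⁺
      ; interface = λ _ _ _ v∈ _ → ∈bagList⁻ v∈
      ; bag⊆      = ∈bagList⁺
      ; small     = λ {z} z∈ → ≮⇒≥ λ large → none (lose z∈ large)
      }
      where
      root : ∃[ r ] r ∈ nodesᵀ
      root with nodesᵀ | IsTree.nonempty isTree
      ... | r ∷ _ | _ = r , here refl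

-- Linear orders of small cutwidth

++-split : ∀ {A : Set} (P : List A) {Q} X {Y} → P ++ Q ≡ X ++ Y →
           (∃[ M ] (X ≡ P ++ M × Q ≡ M ++ Y)) ⊎ (∃[ M ] (P ≡ X ++ M × Y ≡ M ++ Q))
++-split []      X       eq   = inj₁ (X , refl , eq)
++-split (p ∷ P) []      eq   = inj₂ (p ∷ P , refl , sym eq)
++-split (p ∷ P) (x ∷ X) eq with ∷-injective eq
... | refl , eq′ with ++-split P X eq′
...   | inj₁ (M , refl , eq″) = inj₁ (M , refl , eq″)
...   | inj₂ (M , refl , eq″) = inj₂ (M , refl , eq″)

module Order (G : Graph) (τ : ℕ)
  (separation : (S : List (Graph.Vertex G)) → Unique S → 1 ≤ length S → Separation G τ S) where

  open Graph G using (Vertex; Adj)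
  open Count G

  -- The order `L` has cutwidth at most `c` in the subgraph induced by its entries.
  CutsBounded : List Vertex → ℕ → Set
  CutsBounded L c = ∀ P Q → L ≡ P ++ Q → e P Q ≤ c

  -- The separator is placed between recursive orders of the two sides. No edge joins the sides, so
  -- the edges over a cut are at most those over a cut of one side and, in addition, at most `τ * Δ`
  -- edges at the separator. The size condition says that `S` has at most `(3/2) ^ k` vertices, so
  -- `k` rounds reduce it to a single vertex.
  order-exists : ∀ k S → Unique S → length S * 2 ^ k ≤ 3 ^ k →
                 ∃[ L ] (L ↭ S × CutsBounded L (k * (τ * Δ)))
  order-exists zero S u small = S , ↭-refl , cuts S (subst (_≤ 1) (*-identityʳ (length S)) small)
    where
    cuts : ∀ S → length S ≤ 1 → CutsBounded S 0
    cuts S           _ []      Q  eq = z≤n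
    cuts S           _ P       [] eq = ≤-reflexive (e-[]ʳ P)
    cuts (x ∷ y ∷ S) (s≤s ()) (p ∷ P) (q ∷ Q) eq
    cuts (x ∷ []) _ (p ∷ P) (q ∷ Q) eq with P | ∷-injectiveʳ eq
    ... | [] | ()
    ... | _ ∷ _ | ()
  order-exists (suc k) [] u small = [] , ↭-refl , λ { [] Q eq → z≤n }
  order-exists (suc k) S@(_ ∷ _) u small with separation S u (s≤s z≤n)
  ... | sep with order-exists k (Separation.left sep) (proj₁ unique-parts) (smaller (length (Separation.left sep)) (Separation.left≤ sep))
               | order-exists k (Separation.right sep) (proj₂ unique-parts) (smaller (length (Separation.right sep)) (Separation.right≤ sep))
    where
    unique-parts : Unique (Separation.left sep) × Unique (Separation.right sep)
    unique-parts =
      let ul , umr , _ = Unique-++⁻ (Separation.left sep) (Unique-resp-↭ (↭-sym (Separation.perm sep)) u)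
          _ , ur , _ = Unique-++⁻ (Separation.middle sep) umr
      in ul , ur
    smaller : ∀ n → 3 * n ≤ 2 * length S → n * 2 ^ k ≤ 3 ^ k
    smaller n 3n≤ = *-cancelˡ-≤ 3 (begin
      3 * (n * 2 ^ k)               ≡⟨ *-assoc 3 n _ ⟨
      3 * n * 2 ^ k                 ≤⟨ *-monoˡ-≤ (2 ^ k) 3n≤ ⟩
      2 * length S * 2 ^ k          ≡⟨ lemma (length S) (2 ^ k) ⟩
      length S * (2 * 2 ^ k)        ≤⟨ small ⟩
      3 * 3 ^ k                     ∎)
      where
      open ≤-Reasoning
      lemma : ∀ a b → 2 * a * b ≡ a * (2 * b)
      lemma = solve-∀
  ... | Lˡ , pˡ , cutsˡ | Lʳ , pʳ , cutsʳ = L , perm′ , cuts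
    where
    open Separation sep using (middle; perm; middle≤; separate)
    c : ℕ
    c = k * (τ * Δ)
    L : List Vertex
    L = Lˡ ++ middle ++ Lʳ
    perm′ : L ↭ S
    perm′ = ↭-trans (++⁺ pˡ (++⁺ˡ middle pʳ)) perm
    uL : Unique L
    uL = Unique-resp-↭ (↭-sym perm′) u
    none : ∀ P Q → (∀ {x} → x ∈ P → x ∈ Lˡ) → (∀ {x} → x ∈ Q → x ∈ Lʳ) → e P Q ≡ 0
    none P Q P⊆ Q⊆ = e-0 P Q λ u∈ v∈ → separate (∈-resp-↭ pˡ (P⊆ u∈)) (∈-resp-↭ pʳ (Q⊆ v∈))
    mid : ∀ {n} → n ≤ length middle → n * Δ ≤ τ * Δ
    mid n≤ = *-monoˡ-≤ Δ (≤-trans n≤ middle≤)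
    open ≤-Reasoning
    cuts : CutsBounded L (suc k * (τ * Δ))
    cuts P Q eq with ++-split P Lˡ (sym eq)
    ... | inj₁ (M , refl , refl) = begin
      e P (M ++ middle ++ Lʳ)             ≡⟨ e-++ʳ P M _ ⟩
      e P M + e P (middle ++ Lʳ)          ≡⟨ cong (e P M +_) (e-++ʳ P middle Lʳ) ⟩
      e P M + (e P middle + e P Lʳ)       ≡⟨ cong (λ z → e P M + (e P middle + z)) (none P Lʳ ∈-++⁺ˡ id) ⟩
      e P M + (e P middle + 0)            ≡⟨ cong (e P M +_) (+-identityʳ _) ⟩
      e P M + e P middle                  ≤⟨ +-mono-≤ (cutsˡ P M refl)
                                               (e≤ʳ middle (proj₁ (Unique-++⁻ P (proj₁ (Unique-++⁻ (P ++ M) uL))))) ⟩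
      c + length middle * Δ               ≤⟨ +-monoʳ-≤ c (mid ≤-refl) ⟩
      c + τ * Δ                           ≡⟨ +-comm c _ ⟩
      suc k * (τ * Δ)                     ∎
    ... | inj₂ (M , refl , eq′) with ++-split M middle (sym eq′)
    ...   | inj₁ (M′ , refl , refl) = begin
      e (Lˡ ++ M) (M′ ++ Lʳ)                ≡⟨ e-++ˡ Lˡ M (M′ ++ Lʳ) ⟩
      e Lˡ (M′ ++ Lʳ) + e M (M′ ++ Lʳ)      ≡⟨ cong (_+ e M (M′ ++ Lʳ)) (e-++ʳ Lˡ M′ Lʳ) ⟩
      e Lˡ M′ + e Lˡ Lʳ + e M (M′ ++ Lʳ)    ≡⟨ cong (λ z → e Lˡ M′ + z + e M (M′ ++ Lʳ)) (none Lˡ Lʳ id id) ⟩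
      e Lˡ M′ + 0 + e M (M′ ++ Lʳ)          ≤⟨ +-mono-≤ (+-monoˡ-≤ 0 (e≤ʳ M′ (proj₁ (Unique-++⁻ Lˡ uL)))) (e≤ˡ M u′) ⟩
      length M′ * Δ + 0 + length M * Δ      ≡⟨ lemma (length M′) (length M) Δ ⟩
      (length M + length M′) * Δ            ≤⟨ mid (≤-reflexive (sym (length-++ M))) ⟩
      τ * Δ                                 ≤⟨ m≤m+n _ c ⟩
      suc k * (τ * Δ)                       ∎
      where
      u′ : Unique (M′ ++ Lʳ)
      u′ = proj₁ (proj₂ (Unique-++⁻ M (subst Unique (++-assoc M M′ Lʳ) (proj₁ (proj₂ (Unique-++⁻ Lˡ uL))))))
      lemma : ∀ a b d → a * d + 0 + b * d ≡ (b + a) * d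
      lemma = solve-∀
    ...   | inj₂ (M′ , refl , refl) = begin
      e (Lˡ ++ middle ++ M′) Q                  ≡⟨ e-++ˡ Lˡ _ Q ⟩
      e Lˡ Q + e (middle ++ M′) Q               ≡⟨ cong₂ _+_ (none Lˡ Q id (∈-++⁺ʳ M′)) (e-++ˡ middle M′ Q) ⟩
      e middle Q + e M′ Q                       ≤⟨ +-mono-≤ (e≤ˡ middle u′) (cutsʳ M′ Q refl) ⟩
      length middle * Δ + c                     ≤⟨ +-monoˡ-≤ c (mid ≤-refl) ⟩
      suc k * (τ * Δ)                           ∎
      where
      u′ : Unique Q
      u′ = proj₁ (proj₂ (Unique-++⁻ M′ (proj₁ (proj₂ (Unique-++⁻ middle (proj₁ (proj₂ (Unique-++⁻ Lˡ uL))))))))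

-- Windows that split a weight evenly

-- A discrete intermediate value principle.
first-change : ∀ {P : ℕ → Set} → U.Decidable P → ∀ m → ¬ P 0 → P m → ∃[ p ] (p < m × ¬ P p × P (suc p))
first-change P? zero    ¬p0 pm = contradiction pm ¬p0
first-change P? (suc m) ¬p0 pm with P? m
... | no ¬p = m , ≤-refl , ¬p , pm
... | yes p with first-change P? m ¬p0 p
...   | q , q<m , rest = q , m<n⇒m<1+n q<m , rest

module Window {A : Set} (f : A → ℕ) (δ : ℕ) (f≤δ : ∀ x → f x ≤ δ) where

  open ≤-Reasoning

  private
    w : List A → ℕ
    w = weight f

  take-mono : ∀ n R → w (take n R) ≤ w (take (suc n) R)
  take-mono zero    R       = z≤n
  take-mono (suc n) []      = z≤n
  take-mono (suc n) (x ∷ R) = +-monoʳ-≤ (f x) (take-mono n R)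

  take-step : ∀ n R → w (take (suc n) R) ≤ δ + w (take n R)
  take-step n       []      = z≤n
  take-step zero    (x ∷ R) = +-monoˡ-≤ 0 (f≤δ x)
  take-step (suc n) (x ∷ R) = begin
    f x + w (take (suc n) R)    ≤⟨ +-monoʳ-≤ (f x) (take-step n R) ⟩
    f x + (δ + w (take n R))    ≡⟨ lemma (f x) δ _ ⟩
    δ + (f x + w (take n R))    ∎
    where
    lemma : ∀ a b c → a + (b + c) ≡ b + (a + c)
    lemma = solve-∀

  slide-up : ∀ n p L → w (take n (drop (suc p) L)) ≤ δ + w (take n (drop p L))
  slide-up n       p       []      rewrite drop-[] {A = A} p = m≤n+m _ δ
  slide-up zero    zero    (x ∷ L) = z≤n
  slide-up (suc n) zero    (x ∷ L) = ≤-trans (take-step n L) (+-monoʳ-≤ δ (m≤n+m _ (f x)))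
  slide-up n       (suc p) (x ∷ L) = slide-up n p L

  slide-down : ∀ n p L → w (take n (drop p L)) ≤ δ + w (take n (drop (suc p) L))
  slide-down n       p       []      rewrite drop-[] {A = A} p = m≤n+m _ δ
  slide-down zero    zero    (x ∷ L) = z≤n
  slide-down (suc n) zero    (x ∷ L) = +-mono-≤ (f≤δ x) (take-mono n L)
  slide-down n       (suc p) (x ∷ L) = slide-down n p L

  drop-step : ∀ p L → w (drop p L) ≤ δ + w (drop (suc p) L)
  drop-step p       []      rewrite drop-[] {A = A} p = z≤n
  drop-step zero    (x ∷ L) = +-monoˡ-≤ _ (f≤δ x)
  drop-step (suc p) (x ∷ L) = drop-step p L

  drop≤ : ∀ p L → w (drop p L) ≤ w L
  drop≤ p L = subst (w (drop p L) ≤_)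
    (trans (sym (weight-++ f (take p L) (drop p L))) (cong w (take++drop≡id p L))) (m≤n+m _ _)

  drop-anti : ∀ p q L → p ≤ q → w (drop q L) ≤ w (drop p L)
  drop-anti zero    q       L       z≤n     = drop≤ q L
  drop-anti (suc p) (suc q) []      (s≤s _) = z≤n
  drop-anti (suc p) (suc q) (x ∷ L) (s≤s r) = drop-anti p q L r

  module _ (L : List A) (n₁ n₂ : ℕ) (len : length L ≡ n₁ + n₂)
           (n₁≤n₂ : n₁ ≤ n₂) (n₂≤2n₁ : n₂ ≤ suc (n₁ + n₁)) where

    g : ℕ → ℕ
    g p = w (take n₁ (drop p L))

    W : ℕ
    W = w L

    W≡ : W ≡ g 0 + w (drop n₁ L)
    W≡ = trans (cong w (sym (take++drop≡id n₁ L))) (weight-++ f (take n₁ L) (drop n₁ L))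

    tail≡ : w (drop n₂ L) ≡ g n₂
    tail≡ = cong w (sym (take-all n₁ (drop n₂ L) (≤-reflexive
      (trans (length-drop n₂ L) (trans (cong (_∸ n₂) len) (m+n∸n≡m n₁ n₂))))))

    -- The first and the last window do not overlap, because `n₁ ≤ n₂`.
    ends≤ : g 0 + g n₂ ≤ W
    ends≤ = subst₂ _≤_ (cong (g 0 +_) tail≡) (sym W≡) (+-monoʳ-≤ (g 0) (drop-anti n₁ n₂ L n₁≤n₂))

    -- The windows at `0`, `n₁` and `n₂` cover every position except possibly `n₁ + n₁`, because
    -- `n₂ ≤ suc (n₁ + n₁)`; this one position costs the term `δ`.
    ≤thirds : W ≤ g 0 + g n₁ + g n₂ + δ
    ≤thirds = begin
      W                                                   ≡⟨ W≡ ⟩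
      g 0 + w (drop n₁ L)                                 ≡⟨ cong (λ R → g 0 + w R) (take++drop≡id n₁ (drop n₁ L)) ⟨
      g 0 + w (take n₁ (drop n₁ L) ++ drop n₁ (drop n₁ L)) ≡⟨ cong (g 0 +_) (weight-++ f (take n₁ (drop n₁ L)) _) ⟩
      g 0 + (g n₁ + w (drop n₁ (drop n₁ L)))              ≡⟨ cong (λ R → g 0 + (g n₁ + w R)) (drop-drop n₁ n₁ L) ⟩
      g 0 + (g n₁ + w (drop (n₁ + n₁) L))                 ≤⟨ +-monoʳ-≤ (g 0) (+-monoʳ-≤ (g n₁) (begin
          w (drop (n₁ + n₁) L)                            ≤⟨ drop-step (n₁ + n₁) L ⟩
          δ + w (drop (suc (n₁ + n₁)) L)                  ≤⟨ +-monoʳ-≤ δ (drop-anti n₂ (suc (n₁ + n₁)) L n₂≤2n₁) ⟩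
          δ + w (drop n₂ L)                               ≡⟨ cong (δ +_) tail≡ ⟩
          δ + g n₂                                        ∎)) ⟩
      g 0 + (g n₁ + (δ + g n₂))                           ≡⟨ lemma (g 0) (g n₁) δ (g n₂) ⟩
      g 0 + g n₁ + g n₂ + δ                               ∎
      where
      lemma : ∀ a b c d → a + (b + (c + d)) ≡ a + b + d + c
      lemma = solve-∀

    -- Up to the slack `δ`, the window carries at most two thirds and at least one third of the
    -- weight; the latter bounds the complement by two thirds. One slide changes the weight by at
    -- most `δ`, too little to jump over this range.
    Low High : ℕ → Set
    Low p  = 3 * g p ≤ 2 * W + 3 * δ
    High p = W ≤ 3 * g p + 3 * δ

    low? : U.Decidable Low
    low? p = _ ≤? _
    high? : U.Decidable High
    high? p = _ ≤? _

    low-after : ∀ p → ¬ Low p → High (suc p)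
    low-after p ¬low = *-cancelˡ-≤ 2 (+-cancelʳ-≤ (3 * δ) _ _ (begin
      2 * W + 3 * δ                      ≤⟨ <⇒≤ (≰⇒> ¬low) ⟩
      3 * g p                            ≤⟨ *-monoʳ-≤ 3 (slide-down n₁ p L) ⟩
      3 * (δ + g (suc p))                ≤⟨ lemma δ (g (suc p)) ⟩
      2 * (3 * g (suc p) + 3 * δ) + 3 * δ  ∎))
      where
      lemma : ∀ a b → 3 * (a + b) ≤ 2 * (3 * b + 3 * a) + 3 * a
      lemma a b = subst (3 * (a + b) ≤_) (eq a b) (m≤m+n _ (6 * a + 3 * b))
        where
        eq : ∀ a b → 3 * (a + b) + (6 * a + 3 * b) ≡ 2 * (3 * b + 3 * a) + 3 * a
        eq = solve-∀

    high-after : ∀ p → ¬ High p → Low (suc p)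
    high-after p ¬high = begin
      3 * g (suc p)         ≤⟨ *-monoʳ-≤ 3 (slide-up n₁ p L) ⟩
      3 * (δ + g p)         ≡⟨ lemma δ (g p) ⟩
      3 * g p + 3 * δ       ≤⟨ <⇒≤ (≰⇒> ¬high) ⟩
      W                     ≤⟨ m≤m+n W _ ⟩
      2 * W                 ≤⟨ m≤m+n (2 * W) (3 * δ) ⟩
      2 * W + 3 * δ         ∎
      where
      lemma : ∀ a b → 3 * (a + b) ≡ 3 * b + 3 * a
      lemma = solve-∀

    -- If the first window is too heavy, the last one is light, since the two are disjoint. If it is
    -- too light, the window at `n₁` or at `n₂` is heavy, since the three together cover nearly
    -- everything. Sliding from one extreme to the other passes a balanced window.
    balanced-window : ∃[ p ] (p ≤ n₂ × Low p × High p)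
    balanced-window with low? 0 | high? 0
    ... | yes low | yes high = 0 , z≤n , low , high
    ... | no ¬low | _ =
      let p , p< , ¬lowp , low = first-change low? n₂ ¬low lown₂
      in suc p , p< , low , low-after p ¬lowp
      where
      lown₂ : Low n₂
      lown₂ = ≤-trans (+-cancelʳ-≤ (2 * W) (3 * g n₂) W (begin
        3 * g n₂ + 2 * W             ≤⟨ +-monoʳ-≤ (3 * g n₂) (≤-trans (m≤m+n _ (3 * δ)) (<⇒≤ (≰⇒> ¬low))) ⟩
        3 * g n₂ + 3 * g 0           ≡⟨ +-comm (3 * g n₂) _ ⟩
        3 * g 0 + 3 * g n₂           ≡⟨ *-distribˡ-+ 3 (g 0) _ ⟨
        3 * (g 0 + g n₂)             ≤⟨ *-monoʳ-≤ 3 ends≤ ⟩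
        3 * W                        ∎)) (≤-trans (m≤m+n W _) (m≤m+n (2 * W) (3 * δ)))
    ... | yes _ | no ¬high with high? n₁
    ...   | yes high =
      let p , p< , ¬highp , highp = first-change high? n₁ ¬high high
      in suc p , ≤-trans p< n₁≤n₂ , high-after p ¬highp , highp
    ...   | no ¬high₁ =
      let p , p< , ¬highp , highp = first-change high? n₂ ¬high highn₂
      in suc p , p< , high-after p ¬highp , highp
      where
      highn₂ : High n₂
      highn₂ = ≤-trans (+-cancelʳ-≤ (2 * W) W (3 * g n₂) (begin
        3 * W                                          ≤⟨ *-monoʳ-≤ 3 ≤thirds ⟩
        3 * (g 0 + g n₁ + g n₂ + δ)                    ≤⟨ m≤m+n _ (3 * δ) ⟩
        3 * (g 0 + g n₁ + g n₂ + δ) + 3 * δ            ≡⟨ lemma (g 0) (g n₁) (g n₂) δ ⟩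
        3 * g n₂ + ((3 * g 0 + 3 * δ) + (3 * g n₁ + 3 * δ)) ≤⟨ +-monoʳ-≤ (3 * g n₂)
            (+-mono-≤ (<⇒≤ (≰⇒> ¬high)) (≤-trans (<⇒≤ (≰⇒> ¬high₁)) (m≤m+n W 0))) ⟩
        3 * g n₂ + 2 * W                               ∎)) (m≤m+n _ (3 * δ))
        where
        lemma : ∀ a b c d → 3 * (a + b + c + d) + 3 * d ≡ 3 * c + ((3 * a + 3 * d) + (3 * b + 3 * d))
        lemma = solve-∀

record Halves (n N₁ N₂ : ℕ) : Set where
  field
    n₁ n₂  : ℕ
    n₁+n₂≡ : n ≡ n₁ + n₂
    n₁≤    : n₁ ≤ N₁
    n₂≤    : n₂ ≤ N₂
    n₁≤n₂  : n₁ ≤ n₂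
    n₂≤2n₁ : n₂ ≤ suc (n₁ + n₁)

-- Even halves are taken if the smaller region can hold one. Otherwise it is filled completely, and
-- `N₂ ≤ N₁ + N₁` keeps the rest from being more than twice as large.
halves : ∀ n N₁ N₂ → n ≤ N₁ + N₂ → N₁ ≤ N₂ → N₂ ≤ N₁ + N₁ → Halves n N₁ N₂
halves n N₁ N₂ n≤ N₁≤N₂ N₂≤2N₁ with ⌊ n /2⌋ ≤? N₁
... | yes half≤ = record
  { n₁ = ⌊ n /2⌋ ; n₂ = ⌈ n /2⌉ ; n₁+n₂≡ = sym (⌊n/2⌋+⌈n/2⌉≡n n) ; n₁≤ = half≤
  ; n₂≤ = ≤-trans (⌈n/2⌉-mono (≤-trans n≤ (+-monoˡ-≤ N₂ N₁≤N₂))) (≤-reflexive (sym (n≡⌈n+n/2⌉ N₂)))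
  ; n₁≤n₂ = ⌊n/2⌋≤⌈n/2⌉ n
  ; n₂≤2n₁ = ≤-trans (⌊n/2⌋-mono (n≤1+n (suc n))) (s≤s (m≤m+n _ _)) }
... | no half≰ = record
  { n₁ = N₁ ; n₂ = n ∸ N₁ ; n₁+n₂≡ = sym (m+[n∸m]≡n N₁≤n) ; n₁≤ = ≤-refl
  ; n₂≤ = ≤-trans (∸-monoˡ-≤ N₁ n≤) (≤-reflexive (m+n∸m≡n N₁ N₂))
  ; n₁≤n₂ = ≤-trans (≤-reflexive (sym (m+n∸n≡m N₁ N₁))) (∸-monoˡ-≤ N₁ 2N₁≤n)
  ; n₂≤2n₁ = ≤-trans (∸-monoˡ-≤ N₁ n≤) (≤-trans (≤-reflexive (m+n∸m≡n N₁ N₂)) (m≤n⇒m≤1+n N₂≤2N₁)) }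
  where
  2N₁≤n : N₁ + N₁ ≤ n
  2N₁≤n = ≤-trans (+-mono-≤ (<⇒≤ (≰⇒> half≰)) (≤-trans (<⇒≤ (≰⇒> half≰)) (⌊n/2⌋≤⌈n/2⌉ n)))
                  (≤-reflexive (⌊n/2⌋+⌈n/2⌉≡n n))
  N₁≤n : N₁ ≤ n
  N₁≤n = ≤-trans (m≤m+n N₁ N₁) 2N₁≤n

-- In both bounds two thirds of the old outgoing edges are inherited, `Δ` is the granularity of the
-- balanced window, and `2 * κ` accounts for the edges between the parts, since a window is bounded
-- by two cuts of the order.
record Bisection (G : Graph) (S Out : List (Graph.Vertex G)) (N₁ N₂ κ : ℕ) : Set where
  open Count G
  field
    S₁ S₂ : List (Graph.Vertex G)
    perm  : S₁ ++ S₂ ↭ S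
    S₁≤   : length S₁ ≤ N₁
    S₂≤   : length S₂ ≤ N₂
    ext₁≤ : 3 * e S₁ (S₂ ++ Out) ≤ 2 * e S Out + 3 * (Δ + 2 * κ)
    ext₂≤ : 3 * e S₂ (S₁ ++ Out) ≤ 2 * e S Out + 3 * (Δ + 2 * κ)

module Bisect (G : Graph) (τ : ℕ)
  (separation : (S : List (Graph.Vertex G)) → Unique S → 1 ≤ length S → Separation G τ S) where

  open Graph G using (Vertex)
  open Count G
  open Order G τ separation

  -- An initial segment of prescribed length could carry almost all edges to `Out`. A window of that
  -- length can be moved until these edges are balanced, at the price of two cuts instead of one.
  bisect : ∀ S Out N₁ N₂ k → Unique S → Unique Out → length S ≤ N₁ + N₂ → N₁ ≤ N₂ → N₂ ≤ N₁ + N₁ →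
           length S * 2 ^ k ≤ 3 ^ k → Bisection G S Out N₁ N₂ (k * (τ * Δ))
  bisect S Out N₁ N₂ k u uOut size N₁≤N₂ N₂≤2N₁ small
    with halves (length S) N₁ N₂ size N₁≤N₂ N₂≤2N₁ | order-exists k S u small
  ... | h | L , L↭S , cuts = record
    { S₁ = B ; S₂ = A ++ C ; perm = ↭-trans (shifts B A) ABC↭S
    ; S₁≤ = ≤-trans (≤-reflexive |B|) n₁≤
    ; S₂≤ = ≤-trans (≤-reflexive |AC|) n₂≤
    ; ext₁≤ = begin
        3 * e B ((A ++ C) ++ Out)                 ≡⟨ cong (3 *_) (e-++ʳ B (A ++ C) Out) ⟩
        3 * (e B (A ++ C) + e B Out)              ≡⟨ *-distribˡ-+ 3 (e B (A ++ C)) (e B Out) ⟩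
        3 * e B (A ++ C) + 3 * e B Out            ≤⟨ +-mono-≤ (*-monoʳ-≤ 3 cut≤) low ⟩
        3 * (κ + κ) + (2 * W + 3 * Δ)             ≡⟨ lemma₁ κ W Δ ⟩
        2 * W + 3 * (Δ + 2 * κ)                   ≡⟨ cong (λ z → 2 * z + 3 * (Δ + 2 * κ)) W≡e ⟩
        2 * e S Out + 3 * (Δ + 2 * κ)             ∎
    ; ext₂≤ = begin
        3 * e (A ++ C) (B ++ Out)                 ≡⟨ cong (3 *_) (e-++ʳ (A ++ C) B Out) ⟩
        3 * (e (A ++ C) B + e (A ++ C) Out)       ≡⟨ *-distribˡ-+ 3 (e (A ++ C) B) (e (A ++ C) Out) ⟩
        3 * e (A ++ C) B + 3 * e (A ++ C) Out     ≤⟨ +-mono-≤ (*-monoʳ-≤ 3 (subst (_≤ κ + κ) (e-sym B (A ++ C)) cut≤)) rest≤ ⟩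
        3 * (κ + κ) + (2 * W + 3 * Δ)             ≡⟨ lemma₁ κ W Δ ⟩
        2 * W + 3 * (Δ + 2 * κ)                   ≡⟨ cong (λ z → 2 * z + 3 * (Δ + 2 * κ)) W≡e ⟩
        2 * e S Out + 3 * (Δ + 2 * κ)             ∎
    }
    where
    open ≤-Reasoning
    open Halves h
    κ : ℕ
    κ = k * (τ * Δ)
    open Window (λ v → neighbours v Out) Δ (λ v → neighbours≤Δ v uOut) using (Low; High; balanced-window)
    window : ∃[ p ] (p ≤ n₂ ×
      Low L n₁ n₂ (trans (↭-length L↭S) n₁+n₂≡) n₁≤n₂ n₂≤2n₁ p ×
      High L n₁ n₂ (trans (↭-length L↭S) n₁+n₂≡) n₁≤n₂ n₂≤2n₁ p)
    window = balanced-window L n₁ n₂ (trans (↭-length L↭S) n₁+n₂≡) n₁≤n₂ n₂≤2n₁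
    p : ℕ
    p = proj₁ window
    A B C : List Vertex
    A = take p L
    B = take n₁ (drop p L)
    C = drop n₁ (drop p L)
    W : ℕ
    W = e L Out
    low : 3 * e B Out ≤ 2 * W + 3 * Δ
    low = proj₁ (proj₂ (proj₂ window))
    high : W ≤ 3 * e B Out + 3 * Δ
    high = proj₂ (proj₂ (proj₂ window))
    W≡e : W ≡ e S Out
    W≡e = e-↭ˡ Out L↭S
    L≡ : L ≡ A ++ B ++ C
    L≡ = sym (trans (cong (A ++_) (take++drop≡id n₁ (drop p L))) (take++drop≡id p L))
    ABC↭S : A ++ B ++ C ↭ S
    ABC↭S = ↭-trans (↭-reflexive (sym L≡)) L↭S
    |L| : length L ≡ n₁ + n₂
    |L| = trans (↭-length L↭S) n₁+n₂≡
    |B| : length B ≡ n₁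
    |B| = trans (length-take n₁ (drop p L)) (m≤n⇒m⊓n≡m (begin
      n₁                  ≡⟨ m+n∸n≡m n₁ p ⟨
      n₁ + p ∸ p          ≤⟨ ∸-monoˡ-≤ p (+-monoʳ-≤ n₁ (proj₁ (proj₂ window))) ⟩
      n₁ + n₂ ∸ p         ≡⟨ cong (_∸ p) |L| ⟨
      length L ∸ p        ≡⟨ length-drop p L ⟨
      length (drop p L)   ∎))
    |AC| : length (A ++ C) ≡ n₂
    |AC| = +-cancelˡ-≡ n₁ _ _ (trans (trans (cong (_+ length (A ++ C)) (sym |B|)) (sym (length-++ B)))
             (trans (↭-length (↭-trans (shifts B A) ABC↭S)) n₁+n₂≡))
    -- The edges between the window and `A` cross its left boundary, those to `C` its right one.
    cut≤ : e B (A ++ C) ≤ κ + κ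
    cut≤ = begin
      e B (A ++ C)                   ≡⟨ e-++ʳ B A C ⟩
      e B A + e B C                  ≡⟨ cong (_+ e B C) (e-sym B A) ⟩
      e A B + e B C                  ≤⟨ +-mono-≤ (m≤m+n (e A B) (e A C)) (m≤n+m (e B C) (e A C)) ⟩
      e A B + e A C + (e A C + e B C) ≡⟨ cong₂ _+_ (e-++ʳ A B C) (e-++ˡ A B C) ⟨
      e A (B ++ C) + e (A ++ B) C    ≤⟨ +-mono-≤ (cuts A (B ++ C) L≡) (cuts (A ++ B) C (trans L≡ (sym (++-assoc A B C)))) ⟩
      κ + κ                          ∎
    W≡sum : W ≡ e (A ++ C) Out + e B Out
    W≡sum = trans W≡e (trans (e-↭ˡ Out (↭-trans (↭-sym ABC↭S) (shifts A B)))
              (trans (e-++ˡ B (A ++ C) Out) (+-comm (e B Out) _)))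
    -- The window is not too light, so the rest is not too heavy.
    rest≤ : 3 * e (A ++ C) Out ≤ 2 * W + 3 * Δ
    rest≤ = +-cancelʳ-≤ (3 * e B Out) _ _ (begin
      3 * e (A ++ C) Out + 3 * e B Out      ≡⟨ *-distribˡ-+ 3 (e (A ++ C) Out) (e B Out) ⟨
      3 * (e (A ++ C) Out + e B Out)        ≡⟨ cong (3 *_) W≡sum ⟨
      3 * W                                 ≡⟨ lemma₂ W ⟩
      2 * W + W                             ≤⟨ +-monoʳ-≤ (2 * W) high ⟩
      2 * W + (3 * e B Out + 3 * Δ)         ≡⟨ lemma₃ (2 * W) (3 * e B Out) (3 * Δ) ⟩
      2 * W + 3 * Δ + 3 * e B Out           ∎)
      where
      lemma₂ : ∀ a → 3 * a ≡ 2 * a + a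
      lemma₂ = solve-∀
      lemma₃ : ∀ a b c → a + (b + c) ≡ a + c + b
      lemma₃ = solve-∀
    lemma₁ : ∀ a b c → 3 * (a + a) + (2 * b + 3 * c) ≡ 2 * b + 3 * (c + 2 * a)
    lemma₁ = solve-∀

-- Ports

-- The list is cut into `β` blocks of at most `δ` entries, one for each slot. The slots will become
-- lines, so few darts of a region share a line.
assign : ∀ {A : Set} → DecidableEquality A → ∀ β δ (ds : List A) → Unique ds → length ds ≤ β * δ →
         Σ[ g ∈ (A → ℕ) ] ((∀ {d} → d ∈ ds → g d < β) ×
                 (∀ k → length (filter (λ d → g d ℕ.≟ k) ds) ≤ δ))
assign _≟ᴬ_ zero    δ []  u len = (λ _ → 0) , (λ ()) , λ _ → z≤n
assign {A} _≟ᴬ_ (suc β) δ ds u len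
  with assign _≟ᴬ_ β δ (drop δ ds) (Unique.drop⁺ δ u)
         (subst (_≤ β * δ) (sym (length-drop δ ds))
           (≤-trans (∸-monoˡ-≤ δ len) (≤-reflexive (m+n∸m≡n δ (β * δ)))))
... | g , g< , count = g′ , g′< , count′
  where
  open DecMembership _≟ᴬ_ using (_∈?_)
  first rest : List A
  first = take δ ds
  rest  = drop δ ds
  split : first ++ rest ≡ ds
  split = take++drop≡id δ ds
  disjoint : ∀ {x} → x ∈ first → x ∉ rest
  disjoint = proj₂ (proj₂ (Unique-++⁻ first (subst Unique (sym split) u)))
  g′ : A → ℕ
  g′ d with d ∈? first
  ... | yes _ = β
  ... | no _  = g d
  g′-first : ∀ {d} → d ∈ first → g′ d ≡ β
  g′-first {d} d∈ with d ∈? first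
  ... | yes _ = refl
  ... | no d∉ = contradiction d∈ d∉
  g′-rest : ∀ {d} → d ∈ rest → g′ d ≡ g d
  g′-rest {d} d∈ with d ∈? first
  ... | yes d∈′ = contradiction d∈ (disjoint d∈′)
  ... | no _    = refl
  g′< : ∀ {d} → d ∈ ds → g′ d < suc β
  g′< {d} d∈ with ∈-++⁻ first (subst (d ∈_) (sym split) d∈)
  ... | inj₁ d∈₁ = s≤s (≤-reflexive (g′-first d∈₁))
  ... | inj₂ d∈₂ = m<n⇒m<1+n (subst (_< β) (sym (g′-rest d∈₂)) (g< d∈₂))
  open ≤-Reasoning
  count′ : ∀ k → length (filter (λ d → g′ d ℕ.≟ k) ds) ≤ δ
  count′ k = begin
    length (filter P? ds)                                  ≡⟨ cong (λ xs → length (filter P? xs)) split ⟨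
    length (filter P? (first ++ rest))                     ≡⟨ cong length (filter-++ P? first rest) ⟩
    length (filter P? first ++ filter P? rest)             ≡⟨ length-++ (filter P? first) ⟩
    length (filter P? first) + length (filter P? rest)     ≤⟨ bound (k ℕ.≟ β) ⟩
    δ                                                      ∎
    where
    P? : U.Decidable (λ d → g′ d ≡ k)
    P? d = g′ d ℕ.≟ k
    bound : Dec (k ≡ β) → length (filter P? first) + length (filter P? rest) ≤ δ
    bound (yes refl) = begin
      length (filter P? first) + length (filter P? rest)
        ≡⟨ cong (λ xs → length (filter P? first) + length xs) (filter-none P? (All.tabulate λ d∈ g′≡ →
             <-irrefl (trans (sym (g′-rest d∈)) g′≡) (g< d∈))) ⟩
      length (filter P? first) + 0    ≡⟨ +-identityʳ _ ⟩
      length (filter P? first)        ≤⟨ length-filter P? first ⟩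
      length first                    ≡⟨ length-take δ ds ⟩
      δ ⊓ length ds                   ≤⟨ m⊓n≤m δ _ ⟩
      δ                               ∎
    bound (no k≢β) = begin
      length (filter P? first) + length (filter P? rest)
        ≡⟨ cong (λ xs → length xs + length (filter P? rest)) (filter-none P? (All.tabulate λ d∈ g′≡ →
             k≢β (trans (sym g′≡) (g′-first d∈)))) ⟩
      length (filter P? rest)
        ≤⟨ unique-⊆-length (Unique.filter⁺ P? (Unique.drop⁺ δ u)) (λ {d} d∈ →
             let d∈rest , g′≡ = ∈-filter⁻ P? {xs = rest} d∈
             in ∈-filter⁺ (λ d → g d ℕ.≟ k) d∈rest (trans (sym (g′-rest d∈rest)) g′≡)) ⟩
      length (filter (λ d → g d ℕ.≟ k) rest)   ≤⟨ count k ⟩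
      δ                                      ∎

-- The coordinates of 2-adic valuation j are reserved for the ports of one group of levels.
module Marks where

  abstract
    modulus : ℕ → ℕ
    modulus j = 2 ^ suc j

    modulus≡ : ∀ j → modulus j ≡ 2 * 2 ^ j
    modulus≡ j = refl

    instance
      modulus-nonZero : ∀ {j} → NonZero (modulus j)
      modulus-nonZero {j} = m^n≢0 2 (suc j)

  2^<modulus : ∀ j → 2 ^ j < modulus j
  2^<modulus j = subst (2 ^ j <_) (sym (modulus≡ j)) (^-monoʳ-< 2 (s≤s (s≤s z≤n)) (n<1+n j))

  -- Residue `2 ^ j` modulo `2 * 2 ^ j` means that `x` has 2-adic valuation `j`; the classes for
  -- different `j` are disjoint.
  record Marked (j x : ℕ) : Set where
    constructor marked
    field residue : x % modulus j ≡ 2 ^ j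

  marked? : ∀ j x → Dec (Marked j x)
  marked? j x = map′ marked Marked.residue (x % modulus j ℕ.≟ 2 ^ j)

  -- A number of valuation `j` larger than `i` is a multiple of `2 ^ suc i`, so its residue there is
  -- 0 and not `2 ^ i`.
  marked-≮ : ∀ {i j x} → Marked i x → Marked j x → ¬ i < j
  marked-≮ {i} {j} {x} (marked mi) (marked mj) i<j = contradiction (trans (sym mi) x%≡0) (>⇒≢ (m^n>0 2 i))
    where
    r = j ∸ suc i
    split : suc i + r ≡ j
    split = m+[n∸m]≡n i<j
    x≡ : x ≡ (2 ^ r + x / modulus j * (2 * 2 ^ r)) * modulus i
    x≡ = begin
      x                                              ≡⟨ m≡m%n+[m/n]*n x (modulus j) ⟩
      x % modulus j + c * modulus j                  ≡⟨ cong₂ (λ z w → z + c * w) mj (modulus≡ j) ⟩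
      2 ^ j + c * (2 * 2 ^ j)                        ≡⟨ cong (λ z → z + c * (2 * z)) 2^j≡ ⟩
      modulus i * 2 ^ r + c * (2 * (modulus i * 2 ^ r))  ≡⟨ lemma (modulus i) (2 ^ r) c ⟩
      (2 ^ r + c * (2 * 2 ^ r)) * modulus i          ∎
      where
      open ≡-Reasoning
      c = x / modulus j
      2^j≡ : 2 ^ j ≡ modulus i * 2 ^ r
      2^j≡ = trans (cong (2 ^_) (sym split)) (trans (^-distribˡ-+-* 2 (suc i) r) (cong (_* 2 ^ r) (sym (modulus≡ i))))
      lemma : ∀ a b c → a * b + c * (2 * (a * b)) ≡ (b + c * (2 * b)) * a
      lemma = solve-∀
    x%≡0 : x % modulus i ≡ 0
    x%≡0 = trans (cong (_% modulus i) x≡) (m*n%n≡0 (2 ^ r + x / modulus j * (2 * 2 ^ r)) (modulus i))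

  marked-unique : ∀ {i j x} → Marked i x → Marked j x → i ≡ j
  marked-unique {i} {j} {x} mi mj = ≤-antisym (≮⇒≥ (marked-≮ {j} {i} {x} mj mi)) (≮⇒≥ (marked-≮ {i} {j} {x} mi mj))

  -- There is one reserved coordinate per block of length `modulus j`. Counting starts with the
  -- block after the one that contains `x₀`, whose reserved coordinate may precede `x₀`; hence `β`
  -- lines need the width `modulus j * suc β`.
  line : ℕ → ℕ → ℕ → ℕ
  line j x₀ k = 2 ^ j + (suc k + x₀ / modulus j) * modulus j

  line-marked : ∀ j x₀ k → Marked j (line j x₀ k)
  line-marked j x₀ k = marked (trans ([m+kn]%n≡m%n (2 ^ j) (suc k + x₀ / modulus j) (modulus j))
                             (m<n⇒m%n≡m (2^<modulus j)))

  line-injective : ∀ j x₀ {k k′} → line j x₀ k ≡ line j x₀ k′ → k ≡ k′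
  line-injective j x₀ {k} {k′} eq = suc-injective (+-cancelʳ-≡ (x₀ / modulus j) _ _
    (*-cancelʳ-≡ (suc k + x₀ / modulus j) (suc k′ + x₀ / modulus j) (modulus j) (+-cancelˡ-≡ (2 ^ j) _ _ eq)))

  line≥ : ∀ j x₀ k → x₀ ≤ line j x₀ k
  line≥ j x₀ k = begin
    x₀                                           ≡⟨ m≡m%n+[m/n]*n x₀ M ⟩
    x₀ % M + x₀ / M * M                          ≤⟨ +-monoˡ-≤ _ (<⇒≤ (m%n<n x₀ M)) ⟩
    (suc (x₀ / M)) * M                           ≤⟨ *-monoˡ-≤ M (s≤s (m≤n+m _ k)) ⟩
    (suc k + x₀ / M) * M                         ≤⟨ m≤n+m _ (2 ^ j) ⟩
    line j x₀ k                                  ∎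
    where
    open ≤-Reasoning
    M = modulus j

  line< : ∀ j x₀ k {β w} → k < β → modulus j * suc β ≤ w → line j x₀ k < x₀ + w
  line< j x₀ k {β} {w} k<β fits = begin-strict
    2 ^ j + (suc k + x₀ / M) * M        <⟨ +-monoˡ-< _ (2^<modulus j) ⟩
    M + (suc k + x₀ / M) * M            ≡⟨ lemma M k (x₀ / M) ⟩
    x₀ / M * M + M * suc (suc k)        ≤⟨ +-mono-≤ (m/n*n≤m x₀ M) (≤-trans (*-monoʳ-≤ M (s≤s k<β)) fits) ⟩
    x₀ + w                              ∎
    where
    open ≤-Reasoning
    M = modulus j
    lemma : ∀ a k c → a + (1 + k + c) * a ≡ c * a + a * (1 + (1 + k))
    lemma = solve-∀

  module Hits (p : ℕ) .{{_ : NonZero p}} where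

    hit : ℕ → ℕ → ℕ
    hit n x with marked? (n / p) x
    ... | yes _ = 1
    ... | no _  = 0

    -- The number of levels below `n` for which the line `x` is reserved.
    hits : ℕ → ℕ → ℕ
    hits zero    x = 0
    hits (suc n) x = hit n x + hits n x

    hit-marked : ∀ n {x} → Marked (n / p) x → hit n x ≡ 1
    hit-marked n {x} m with marked? (n / p) x
    ... | yes _ = refl
    ... | no ¬m = contradiction m ¬m

    -- Only the `p` consecutive levels from `q * p` on reserve `x`. The second bound counts those
    -- below `n`; it carries the induction, and it yields the first because a level `n` with `n / p`
    -- equal to `q` lies below `q * p + p`.
    hits≤-with : ∀ {q x} → Marked q x → ∀ n → hits n x ≤ p × hits n x ≤ n ∸ q * p
    hits≤-with {q} {x} mq zero = z≤n , z≤n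
    hits≤-with {q} {x} mq (suc n) with marked? (n / p) x | hits≤-with {q} {x} mq n
    ... | no _ | ≤p , ≤n = ≤p , ≤-trans ≤n (∸-monoˡ-≤ (q * p) (n≤1+n n))
    ... | yes m | ≤p , ≤n with marked-unique {x = x} m mq
    ...   | refl = ≤-trans step (≤-trans (∸-monoˡ-≤ qp (≤-trans (≤-reflexive (cong suc (m≡m%n+[m/n]*n n p)))
                                     (+-monoˡ-≤ qp (m%n<n n p)))) (≤-reflexive (m+n∸n≡m p qp)))
                 , step
      where
      qp = n / p * p
      step : suc (hits n x) ≤ suc n ∸ qp
      step = ≤-trans (s≤s ≤n) (≤-reflexive (sym (+-∸-assoc 1 (m/n*n≤m n p))))

    hits≤ : ∀ n x → hits n x ≤ p
    hits≤ zero    x = z≤n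
    hits≤ (suc n) x with marked? (n / p) x
    ... | no _  = hits≤ n x
    ... | yes m = ≤-trans (≤-reflexive (cong (_+ hits n x) (sym (hit-marked n m)))) (proj₁ (hits≤-with {x = x} m (suc n)))

  module _ {A : Set} (p : ℕ) .{{_ : NonZero p}} {δ : ℕ} {ds : List A} (u : Unique ds) (g : A → ℕ)
           (count : ∀ k → length (filter (λ d → g d ℕ.≟ k) ds) ≤ δ) where

    open Hits p

    -- If some dart `d` gets the coordinate `x`, then `x` is reserved for level `n`, and by
    -- injectivity of `line` all darts at `x` share the slot of `d`.
    count-line : ∀ n x₀ x → length (filter (λ d → line (n / p) x₀ (g d) ℕ.≟ x) ds) ≤ δ * hit n x
    count-line n x₀ x = bound (filter P? ds) refl
      where
      open ≤-Reasoning
      P? : U.Decidable (λ d → line (n / p) x₀ (g d) ≡ x)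
      P? d = line (n / p) x₀ (g d) ℕ.≟ x
      bound : ∀ ds′ → filter P? ds ≡ ds′ → length ds′ ≤ δ * hit n x
      bound []        _  = z≤n
      bound (d ∷ ds′) eq = begin
        suc (length ds′)                           ≡⟨ cong length eq ⟨
        length (filter P? ds)                      ≤⟨ unique-⊆-length (Unique.filter⁺ P? u) same ⟩
        length (filter (λ d′ → g d′ ℕ.≟ g d) ds)     ≤⟨ count (g d) ⟩
        δ                                          ≡⟨ *-identityʳ δ ⟨
        δ * 1                                      ≡⟨ cong (δ *_) (hit-marked n (subst (Marked (n / p)) ld (line-marked (n / p) x₀ (g d)))) ⟨
        δ * hit n x                                ∎
        where
        ld : line (n / p) x₀ (g d) ≡ x
        ld = proj₂ (∈-filter⁻ P? {xs = ds} (subst (d ∈_) (sym eq) (here refl)))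
        same : ∀ {d′} → d′ ∈ filter P? ds → d′ ∈ filter (λ d′ → g d′ ℕ.≟ g d) ds
        same d′∈ = let d′∈ds , l≡ = ∈-filter⁻ P? {xs = ds} d′∈
                   in ∈-filter⁺ (λ d′ → g d′ ℕ.≟ g d) d′∈ds (line-injective (n / p) x₀ (trans l≡ (sym ld)))

-- Layouts in two-dimensional regions

data Direction : Set where
  horizontal vertical : Direction

flip : Direction → Direction
flip horizontal = vertical
flip vertical   = horizontal

Point : Set
Point = ℕ × ℕ

transpose : Point → Point
transpose (x , y) = y , x

record Box : Set where
  constructor box
  field x₀ width y₀ height : ℕ

transposeBox : Box → Box
transposeBox (box x₀ w y₀ h) = box y₀ h x₀ w

record Inside (b : Box) (p : Point) : Set where
  constructor inside
  open Box b
  field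
    x≥ : x₀ ≤ proj₁ p
    x< : proj₁ p < x₀ + width
    y≥ : y₀ ≤ proj₂ p
    y< : proj₂ p < y₀ + height

inside-transpose : ∀ {b p} → Inside b p → Inside (transposeBox b) (transpose p)
inside-transpose (inside a b c d) = inside c d a b

module Routes (Label : Set) where

  -- L horizontal x y and L vertical x y are the labels that may use the edge from (x , y) to
  -- (x + 1 , y) and to (x , y + 1), respectively.
  Routing : Set
  Routing = Direction → ℕ → ℕ → List Label

  transposeR : Routing → Routing
  transposeR L dir x y = L (flip dir) y x

  -- `Q` selects the labels that belong to one guest edge. Each step must exhibit a permitted label
  -- in `Q`, so congestion can be bounded by counting the labels of a host edge.
  data Step (b : Box) (L : Routing) (Q : Label → Set) : Point → Point → Set where
    east  : ∀ {x y d} → Inside b (x , y) → Inside b (suc x , y) → d ∈ L horizontal x y → Q d →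
            Step b L Q (x , y) (suc x , y)
    west  : ∀ {x y d} → Inside b (x , y) → Inside b (suc x , y) → d ∈ L horizontal x y → Q d →
            Step b L Q (suc x , y) (x , y)
    north : ∀ {x y d} → Inside b (x , y) → Inside b (x , suc y) → d ∈ L vertical x y → Q d →
            Step b L Q (x , y) (x , suc y)
    south : ∀ {x y d} → Inside b (x , y) → Inside b (x , suc y) → d ∈ L vertical x y → Q d →
            Step b L Q (x , suc y) (x , y)

  Route : Box → Routing → (Label → Set) → Point → Point → Set
  Route b L Q = Star (Step b L Q)

  module _ {b : Box} {L : Routing} {Q : Label → Set} where

    step-sym : ∀ {p q} → Step b L Q p q → Step b L Q q p
    step-sym (east i j d∈ Qd)  = west i j d∈ Qd
    step-sym (west i j d∈ Qd)  = east i j d∈ Qd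
    step-sym (north i j d∈ Qd) = south i j d∈ Qd
    step-sym (south i j d∈ Qd) = north i j d∈ Qd

    route-sym : ∀ {p q} → Route b L Q p q → Route b L Q q p
    route-sym = Star.reverse step-sym

    step-transpose : ∀ {p q} → Step b L Q p q →
                     Step (transposeBox b) (transposeR L) Q (transpose p) (transpose q)
    step-transpose (east i j d∈ Qd)  = north (inside-transpose i) (inside-transpose j) d∈ Qd
    step-transpose (west i j d∈ Qd)  = south (inside-transpose i) (inside-transpose j) d∈ Qd
    step-transpose (north i j d∈ Qd) = east (inside-transpose i) (inside-transpose j) d∈ Qd
    step-transpose (south i j d∈ Qd) = west (inside-transpose i) (inside-transpose j) d∈ Qd

    route-transpose : ∀ {p q} → Route b L Q p q →
                      Route (transposeBox b) (transposeR L) Q (transpose p) (transpose q)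
    route-transpose = Star.gmap transpose step-transpose

    route-mono : ∀ {b′ L′} {Q′ : Label → Set} → (∀ {p} → Inside b p → Inside b′ p) →
      (∀ dir {x y} → Inside b (x , y) → ∀ {d} → d ∈ L dir x y → d ∈ L′ dir x y) →
      (∀ {d} → Q d → Q′ d) → ∀ {p q} → Route b L Q p q → Route b′ L′ Q′ p q
    route-mono {b′} {L′} {Q′} ins sub Q⊆ = Star.map step
      where
      step : ∀ {p q} → Step b L Q p q → Step b′ L′ Q′ p q
      step (east i j d∈ Qd)  = east (ins i) (ins j) (sub horizontal i d∈) (Q⊆ Qd)
      step (west i j d∈ Qd)  = west (ins i) (ins j) (sub horizontal i d∈) (Q⊆ Qd)
      step (north i j d∈ Qd) = north (ins i) (ins j) (sub vertical i d∈) (Q⊆ Qd)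
      step (south i j d∈ Qd) = south (ins i) (ins j) (sub vertical i d∈) (Q⊆ Qd)

  east-run : ∀ {b L} {Q : Label → Set} n {x y d} → (∀ x → d ∈ L horizontal x y) → Q d →
             Inside b (x , y) → Inside b (n + x , y) → Route b L Q (x , y) (n + x , y)
  east-run zero    d∈ Qd i j = ε
  east-run (suc n) {x} d∈ Qd i j = east-run n d∈ Qd i k ◅◅ (east k j (d∈ (n + x)) Qd ◅ ε)
    where
    k = inside (≤-trans (Inside.x≥ i) (m≤n+m x n)) (<-trans (n<1+n _) (Inside.x< j)) (Inside.y≥ i) (Inside.y< i)

  horizontal-run : ∀ {b L} {Q : Label → Set} {x x′ y d} → (∀ x → d ∈ L horizontal x y) → Q d →
                   Inside b (x , y) → Inside b (x′ , y) → Route b L Q (x , y) (x′ , y)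
  horizontal-run {b} {L} {Q} {x} {x′} {y} d∈ Qd i j with ≤-total x x′
  ... | inj₁ x≤x′ = subst (λ z → Route b L Q (x , y) (z , y)) (m∸n+n≡m x≤x′)
    (east-run (x′ ∸ x) d∈ Qd i (subst (λ z → Inside b (z , y)) (sym (m∸n+n≡m x≤x′)) j))
  ... | inj₂ x′≤x = route-sym (subst (λ z → Route b L Q (x′ , y) (z , y)) (m∸n+n≡m x′≤x)
    (east-run (x ∸ x′) d∈ Qd j (subst (λ z → Inside b (z , y)) (sym (m∸n+n≡m x′≤x)) i)))

  vertical-run : ∀ {b L} {Q : Label → Set} {x y y′ d} → (∀ y → d ∈ L vertical x y) → Q d →
                 Inside b (x , y) → Inside b (x , y′) → Route b L Q (x , y) (x , y′)
  vertical-run {b} {L} {Q} {x} {y} {y′} d∈ Qd i j =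
    Star.map untranspose (route-transpose
      (horizontal-run {transposeBox b} {transposeR L} d∈ Qd (inside-transpose i) (inside-transpose j)))
    where
    untranspose : ∀ {p q} → Step (transposeBox (transposeBox b)) (transposeR (transposeR L)) Q p q → Step b L Q p q
    untranspose (east i j d∈ Qd)  = east i j d∈ Qd
    untranspose (west i j d∈ Qd)  = west i j d∈ Qd
    untranspose (north i j d∈ Qd) = north i j d∈ Qd
    untranspose (south i j d∈ Qd) = south i j d∈ Qd

  bent-run : ∀ {b L} {Q : Label → Set} {x y x′ y′ d d′} →
             (∀ x → d ∈ L horizontal x y) → Q d → (∀ y → d′ ∈ L vertical x′ y) → Q d′ →
             Inside b (x , y) → Inside b (x′ , y′) → Route b L Q (x , y) (x′ , y′)
  bent-run d∈ Qd d′∈ Qd′ i j = horizontal-run d∈ Qd i corner ◅◅ vertical-run d′∈ Qd′ corner j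
    where corner = inside (Inside.x≥ j) (Inside.x< j) (Inside.y≥ i) (Inside.y< i)

module Layouts (G : Graph) (p : ℕ) .{{_ : NonZero p}} (K : ℕ) where

  open Graph G using (Vertex; Adj; adj?; adj-sym)
  open Count G
  open Marks.Hits p

  -- An edge that leaves a vertex set is a dart pointing out of it. An edge cut by a bisection gives
  -- two darts, one out of each part, so its two half-routes have separate ports and labels.
  Dart : Set
  Dart = Vertex × Vertex

  _≟ᴰ_ : DecidableEquality Dart
  _≟ᴰ_ = Product.≡-dec (Graph._≟_ G) (Graph._≟_ G)

  open Routes Dart
  open DecMembership (Graph._≟_ G) using (_∈?_)

  darts : List Vertex → List Vertex → List Dart
  darts []      Q = []
  darts (u ∷ P) Q = map (u ,_) (filter (adj? u) Q) ++ darts P Q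

  length-darts : ∀ P Q → length (darts P Q) ≡ e P Q
  length-darts []      Q = refl
  length-darts (u ∷ P) Q = trans (length-++ (map (u ,_) (filter (adj? u) Q)))
    (cong₂ _+_ (length-map (u ,_) (filter (adj? u) Q)) (length-darts P Q))

  ∈-darts⁺ : ∀ {P Q u v} → u ∈ P → v ∈ Q → Adj u v → (u , v) ∈ darts P Q
  ∈-darts⁺ {u ∷ P} {Q} (here refl) v∈ uv = ∈-++⁺ˡ (∈-map⁺ (u ,_) (∈-filter⁺ (adj? u) v∈ uv))
  ∈-darts⁺ {w ∷ P} {Q} (there u∈)  v∈ uv = ∈-++⁺ʳ (map (w ,_) (filter (adj? w) Q)) (∈-darts⁺ u∈ v∈ uv)

  ∈-darts⁻ : ∀ P Q {u v} → (u , v) ∈ darts P Q → u ∈ P × v ∈ Q × Adj u v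
  ∈-darts⁻ (w ∷ P) Q uv∈ with ∈-++⁻ (map (w ,_) (filter (adj? w) Q)) uv∈
  ... | inj₂ uv∈′ = let u∈ , v∈ , uv = ∈-darts⁻ P Q uv∈′ in there u∈ , v∈ , uv
  ... | inj₁ uv∈′ with ∈-map⁻ (w ,_) uv∈′
  ...   | v , v∈ , refl = let v∈Q , wv = ∈-filter⁻ (adj? w) {xs = Q} v∈ in here refl , v∈Q , wv

  Unique-darts : ∀ {P Q} → Unique P → Unique Q → Unique (darts P Q)
  Unique-darts {[]} _ _ = []
  Unique-darts {w ∷ P} {Q} (w∉ ∷ uP) uQ = Unique.++⁺
    (Unique.map⁺ (λ { refl → refl }) (Unique.filter⁺ (adj? w) uQ)) (Unique-darts uP uQ) disjoint
    where
    disjoint : ∀ {d} → ¬ (d ∈ map (w ,_) (filter (adj? w) Q) × d ∈ darts P Q)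
    disjoint (d∈ , d∈′) with ∈-map⁻ (w ,_) d∈
    ... | v , _ , refl = All.lookup w∉ (proj₁ (∈-darts⁻ P Q d∈′)) refl

  Ports : Set
  Ports = Dart → Point

  inRow inCol : Ports → List Dart → ℕ → List Dart
  inRow port ds y = filter (λ d → proj₂ (port d) ℕ.≟ y) ds
  inCol port ds x = filter (λ d → proj₁ (port d) ℕ.≟ x) ds

  -- `K * Δ` pays for the base regions. A level that reserves the line adds `Δ` three times: once
  -- for the ports inside the layout of the part itself, and once for either of the two parts when
  -- they are glued.
  load : ℕ → ℕ → ℕ
  load n x = K * Δ + 3 * (Δ * hits n x)

  -- The edges leaving S are routed up to their ports only.
  record Layout (n : ℕ) (b : Box) (S Out : List Vertex) (port : Ports) : Set where
    field
      φ       : Vertex → Point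
      L       : Routing
      φ-in    : ∀ {v} → v ∈ S → Inside b (φ v)
      φ-inj   : ∀ {u v} → u ∈ S → v ∈ S → φ u ≡ φ v → u ≡ v
      to-port : ∀ {u v} → u ∈ S → v ∈ Out → Adj u v →
                Route b L (_≡ (u , v)) (φ u) (port (u , v))
      between : ∀ {u v} → u ∈ S → v ∈ S → Adj u v →
                Route b L (λ d → d ≡ (u , v) ⊎ d ≡ (v , u)) (φ u) (φ v)
      row-load : ∀ x y → length (L horizontal x y) ≤ load n y + length (inRow port (darts S Out) y)
      col-load : ∀ x y → length (L vertical x y) ≤ load n x + length (inCol port (darts S Out) x)

  transposeL : ∀ {n b S Out port} → Layout n (transposeBox b) S Out (transpose ∘ port) → Layout n b S Out port
  transposeL l = record
    { φ        = transpose ∘ φ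
    ; L        = transposeR L
    ; φ-in     = inside-transpose ∘ φ-in
    ; φ-inj    = λ u∈ v∈ eq → φ-inj u∈ v∈ (cong transpose eq)
    ; to-port  = λ u∈ v∈ uv → route-transpose (to-port u∈ v∈ uv)
    ; between  = λ u∈ v∈ uv → route-transpose (between u∈ v∈ uv)
    ; row-load = λ x y → col-load y x
    ; col-load = λ x y → row-load y x
    }
    where open Layout l

  index : List Vertex → Vertex → ℕ
  index []      v = 0
  index (u ∷ S) v with Graph._≟_ G u v
  ... | yes _ = 0
  ... | no _  = suc (index S v)

  index< : ∀ {S v} → v ∈ S → index S v < length S
  index< {u ∷ S} {v} v∈ with Graph._≟_ G u v
  ... | yes _ = s≤s z≤n
  index< {u ∷ S} (here refl) | no u≢v = contradiction refl u≢v
  index< {u ∷ S} (there v∈)  | no _   = s≤s (index< v∈)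

  index-inj : ∀ {S u v} → u ∈ S → v ∈ S → index S u ≡ index S v → u ≡ v
  index-inj {w ∷ S} {u} {v} u∈ v∈ eq with Graph._≟_ G w u | Graph._≟_ G w v
  ... | yes refl | yes refl = refl
  index-inj {w ∷ S} (here refl) v∈ eq | no w≢u | no _ = contradiction refl w≢u
  index-inj {w ∷ S} (there u∈) (here refl) eq | no _ | no w≢v = contradiction refl w≢v
  index-inj {w ∷ S} (there u∈) (there v∈) eq | no _ | no _ = index-inj u∈ v∈ (suc-injective eq)

  -- The vertices are placed in row-major order, and every dart may use every edge. This is
  -- affordable because a set of bounded size has only `O(Δ)` darts.
  small-layout : ∀ n x₀ w y₀ h S Out port .{{_ : NonZero w}} → Unique S → Unique Out →
    length S ≤ w * h → 2 * length S ≤ K → (∀ {d} → d ∈ darts S Out → Inside (box x₀ w y₀ h) (port d)) →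
    Layout n (box x₀ w y₀ h) S Out port
  small-layout n x₀ w y₀ h S Out port uS uOut fits small ports-in = record
    { φ = φ
    ; L = λ _ _ _ → all
    ; φ-in = φ-in
    ; φ-inj = λ {u} {v} u∈ v∈ eq → index-inj u∈ v∈ (trans (m≡m%n+[m/n]*n (index S u) w)
        (trans (cong₂ (λ a b → a + b * w)
                 (+-cancelˡ-≡ x₀ _ _ (cong proj₁ eq)) (+-cancelˡ-≡ y₀ _ _ (cong proj₂ eq)))
               (sym (m≡m%n+[m/n]*n (index S v) w))))
    ; to-port = λ u∈ v∈ uv →
        let d∈ = ∈-darts⁺ u∈ v∈ uv
        in run (∈-++⁺ˡ d∈) refl (φ-in u∈) (ports-in d∈)
    ; between = λ u∈ v∈ uv →
        run (∈-++⁺ʳ (darts S Out) (∈-darts⁺ u∈ v∈ uv)) (inj₁ refl) (φ-in u∈) (φ-in v∈)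
    ; row-load = λ _ y → ≤-trans all≤ (≤-trans (m≤m+n (K * Δ) (3 * (Δ * hits n y))) (m≤m+n (load n y) _))
    ; col-load = λ x _ → ≤-trans all≤ (≤-trans (m≤m+n (K * Δ) (3 * (Δ * hits n x))) (m≤m+n (load n x) _))
    }
    where
    all : List Dart
    all = darts S Out ++ darts S S
    φ : Vertex → Point
    φ v = x₀ + index S v % w , y₀ + index S v / w
    φ-in : ∀ {v} → v ∈ S → Inside (box x₀ w y₀ h) (φ v)
    φ-in {v} v∈ = inside (m≤m+n x₀ _) (+-monoʳ-< x₀ (m%n<n (index S v) w)) (m≤m+n y₀ _)
      (+-monoʳ-< y₀ (m<n*o⇒m/o<n (<-≤-trans (index< v∈) (≤-trans fits (≤-reflexive (*-comm w h))))))
    run : ∀ {Q : Dart → Set} {d p q} → d ∈ all → Q d → Inside (box x₀ w y₀ h) p → Inside (box x₀ w y₀ h) q →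
          Route (box x₀ w y₀ h) (λ _ _ _ → all) Q p q
    run d∈ Qd = bent-run (λ _ → d∈) Qd (λ _ → d∈) Qd
    open ≤-Reasoning
    all≤ : length all ≤ K * Δ
    all≤ = begin
      length all                               ≡⟨ length-++ (darts S Out) ⟩
      length (darts S Out) + length (darts S S) ≡⟨ cong₂ _+_ (length-darts S Out) (length-darts S S) ⟩
      e S Out + e S S                          ≤⟨ +-mono-≤ (e≤ˡ S uOut) (e≤ˡ S uS) ⟩
      length S * Δ + length S * Δ              ≡⟨ lemma (length S) Δ ⟩
      2 * length S * Δ                         ≤⟨ *-monoˡ-≤ Δ small ⟩
      K * Δ                                    ∎
      where
      lemma : ∀ a b → a * b + a * b ≡ 2 * a * b
      lemma = solve-∀

  -- Routes climb from a port of a part along its row and then along the column of a port of the whole.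
  module Glue
    {n x₀ w₁ w₂ y₀ h : ℕ} {S S₁ S₂ Out : List Vertex} {port port₁ port₂ : Ports}
    (perm : S₁ ++ S₂ ↭ S)
    (ports-in : ∀ {d} → d ∈ darts S Out → Inside (box x₀ (w₁ + w₂) y₀ h) (port d))
    (ports-in₁ : ∀ {d} → d ∈ darts S₁ (S₂ ++ Out) → Inside (box x₀ w₁ y₀ h) (port₁ d))
    (ports-in₂ : ∀ {d} → d ∈ darts S₂ (S₁ ++ Out) → Inside (box (x₀ + w₁) w₂ y₀ h) (port₂ d))
    (row₁ : ∀ y → length (inRow port₁ (darts S₁ (S₂ ++ Out)) y) ≤ Δ * hit n y)
    (row₂ : ∀ y → length (inRow port₂ (darts S₂ (S₁ ++ Out)) y) ≤ Δ * hit n y)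
    (col₁ : ∀ x → length (inCol port₁ (darts S₁ (S₂ ++ Out)) x) ≤ Δ * hit n x)
    (col₂ : ∀ x → length (inCol port₂ (darts S₂ (S₁ ++ Out)) x) ≤ Δ * hit n x)
    (l₁ : Layout n (box x₀ w₁ y₀ h) S₁ (S₂ ++ Out) port₁)
    (l₂ : Layout n (box (x₀ + w₁) w₂ y₀ h) S₂ (S₁ ++ Out) port₂)
    where

    private
      module l₁ = Layout l₁
      module l₂ = Layout l₂
      b b₁ b₂ : Box
      b  = box x₀ (w₁ + w₂) y₀ h
      b₁ = box x₀ w₁ y₀ h
      b₂ = box (x₀ + w₁) w₂ y₀ h
      D D₁ D₂ : List Dart
      D  = darts S Out
      D₁ = darts S₁ (S₂ ++ Out)
      D₂ = darts S₂ (S₁ ++ Out)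

    inside₁ : ∀ {p} → Inside b₁ p → Inside b p
    inside₁ (inside x≥ x< y≥ y<) = inside x≥ (<-≤-trans x< (+-monoʳ-≤ x₀ (m≤m+n w₁ w₂))) y≥ y<

    inside₂ : ∀ {p} → Inside b₂ p → Inside b p
    inside₂ (inside x≥ x< y≥ y<) =
      inside (≤-trans (m≤m+n x₀ w₁) x≥) (<-≤-trans x< (≤-reflexive (+-assoc x₀ w₁ w₂))) y≥ y<

    φ : Vertex → Point
    φ v with v ∈? S₁
    ... | yes _ = l₁.φ v
    ... | no _  = l₂.φ v

    old : Direction → ℕ → ℕ → List Dart
    old dir x y with x <? x₀ + w₁
    ... | yes _ = l₁.L dir x y
    ... | no _  = l₂.L dir x y

    -- A line is released in its full length to the darts with a port on it, so loads are counted
    -- per line and not per segment.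
    new : Direction → ℕ → ℕ → List Dart
    new horizontal x y = inRow port₁ D₁ y ++ inRow port₂ D₂ y
    new vertical   x y = inCol port D x ++ inCol port₁ D₁ x ++ inCol port₂ D₂ x

    L : Routing
    L dir x y = old dir x y ++ new dir x y

    L₁⊆ : ∀ dir {x y} → Inside b₁ (x , y) → ∀ {d} → d ∈ l₁.L dir x y → d ∈ L dir x y
    L₁⊆ dir {x} i d∈ with x <? x₀ + w₁
    ... | yes _ = ∈-++⁺ˡ d∈
    ... | no x≮ = contradiction (Inside.x< i) x≮

    L₂⊆ : ∀ dir {x y} → Inside b₂ (x , y) → ∀ {d} → d ∈ l₂.L dir x y → d ∈ L dir x y
    L₂⊆ dir {x} i d∈ with x <? x₀ + w₁
    ... | yes x< = contradiction (Inside.x≥ i) (<⇒≱ x<)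
    ... | no _   = ∈-++⁺ˡ d∈

    lift₁ : ∀ {Q Q′ : Dart → Set} → (∀ {d} → Q d → Q′ d) → ∀ {p q} → Route b₁ l₁.L Q p q → Route b L Q′ p q
    lift₁ = route-mono inside₁ L₁⊆

    lift₂ : ∀ {Q Q′ : Dart → Set} → (∀ {d} → Q d → Q′ d) → ∀ {p q} → Route b₂ l₂.L Q p q → Route b L Q′ p q
    lift₂ = route-mono inside₂ L₂⊆

    row₁∈ : ∀ {d} → d ∈ D₁ → ∀ x → d ∈ L horizontal x (proj₂ (port₁ d))
    row₁∈ d∈ x = ∈-++⁺ʳ (old horizontal x _) (∈-++⁺ˡ (∈-filter⁺ _ d∈ refl))

    row₂∈ : ∀ {d} → d ∈ D₂ → ∀ x → d ∈ L horizontal x (proj₂ (port₂ d))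
    row₂∈ d∈ x = ∈-++⁺ʳ (old horizontal x _) (∈-++⁺ʳ (inRow port₁ D₁ _) (∈-filter⁺ _ d∈ refl))

    col∈ : ∀ {d} → d ∈ D → ∀ y → d ∈ L vertical (proj₁ (port d)) y
    col∈ d∈ y = ∈-++⁺ʳ (old vertical _ y) (∈-++⁺ˡ (∈-filter⁺ _ d∈ refl))

    col₂∈ : ∀ {d} → d ∈ D₂ → ∀ y → d ∈ L vertical (proj₁ (port₂ d)) y
    col₂∈ d∈ y = ∈-++⁺ʳ (old vertical _ y)
      (∈-++⁺ʳ (inCol port D _) (∈-++⁺ʳ (inCol port₁ D₁ _) (∈-filter⁺ _ d∈ refl)))

    data Side (v : Vertex) : Set where
      first  : v ∈ S₁ → φ v ≡ l₁.φ v → Side v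
      second : v ∈ S₂ → φ v ≡ l₂.φ v → Side v

    side : ∀ {v} → v ∈ S → Side v
    side {v} v∈ with v ∈? S₁ in eq | ∈-++⁻ S₁ (∈-resp-↭ (↭-sym perm) v∈)
    ... | yes v∈₁ | _         = first v∈₁ (cong-φ eq)
      where
      cong-φ : (v ∈? S₁) ≡ yes v∈₁ → φ v ≡ l₁.φ v
      cong-φ eq rewrite eq = refl
    ... | no v∉₁  | inj₁ v∈₁  = contradiction v∈₁ v∉₁
    ... | no v∉₁  | inj₂ v∈₂  = second v∈₂ (cong-φ eq)
      where
      cong-φ : (v ∈? S₁) ≡ no v∉₁ → φ v ≡ l₂.φ v
      cong-φ eq rewrite eq = refl

    φ-in : ∀ {v} → v ∈ S → Inside b (φ v)
    φ-in v∈ with side v∈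
    ... | first v∈₁ eq  = subst (Inside b) (sym eq) (inside₁ (l₁.φ-in v∈₁))
    ... | second v∈₂ eq = subst (Inside b) (sym eq) (inside₂ (l₂.φ-in v∈₂))

    apart : ∀ {p q} → Inside b₁ p → Inside b₂ q → p ≢ q
    apart i j refl = <⇒≱ (Inside.x< i) (Inside.x≥ j)

    φ-inj : ∀ {u v} → u ∈ S → v ∈ S → φ u ≡ φ v → u ≡ v
    φ-inj u∈ v∈ eq with side u∈ | side v∈
    ... | first u∈₁ eqᵤ  | first v∈₁ eqᵥ  = l₁.φ-inj u∈₁ v∈₁ (trans (sym eqᵤ) (trans eq eqᵥ))
    ... | second u∈₂ eqᵤ | second v∈₂ eqᵥ = l₂.φ-inj u∈₂ v∈₂ (trans (sym eqᵤ) (trans eq eqᵥ))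
    ... | first u∈₁ eqᵤ  | second v∈₂ eqᵥ =
      contradiction (trans (sym eqᵤ) (trans eq eqᵥ)) (apart (l₁.φ-in u∈₁) (l₂.φ-in v∈₂))
    ... | second u∈₂ eqᵤ | first v∈₁ eqᵥ  =
      contradiction (trans (sym eqᵥ) (trans (sym eq) eqᵤ)) (apart (l₁.φ-in v∈₁) (l₂.φ-in u∈₂))

    to-port : ∀ {u v} → u ∈ S → v ∈ Out → Adj u v → Route b L (_≡ (u , v)) (φ u) (port (u , v))
    to-port {u} {v} u∈ v∈ uv with side u∈
    ... | first u∈₁ eq = subst (λ z → Route b L _ z _) (sym eq)
      (lift₁ id (l₁.to-port u∈₁ (∈-++⁺ʳ S₂ v∈) uv) ◅◅
       bent-run (row₁∈ d∈) refl (col∈ d∈′) refl (inside₁ (ports-in₁ d∈)) (ports-in d∈′))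
      where
      d∈ : (u , v) ∈ D₁
      d∈ = ∈-darts⁺ u∈₁ (∈-++⁺ʳ S₂ v∈) uv
      d∈′ : (u , v) ∈ D
      d∈′ = ∈-darts⁺ u∈ v∈ uv
    ... | second u∈₂ eq = subst (λ z → Route b L _ z _) (sym eq)
      (lift₂ id (l₂.to-port u∈₂ (∈-++⁺ʳ S₁ v∈) uv) ◅◅
       bent-run (row₂∈ d∈) refl (col∈ d∈′) refl (inside₂ (ports-in₂ d∈)) (ports-in d∈′))
      where
      d∈ : (u , v) ∈ D₂
      d∈ = ∈-darts⁺ u∈₂ (∈-++⁺ʳ S₁ v∈) uv
      d∈′ : (u , v) ∈ D
      d∈′ = ∈-darts⁺ u∈ v∈ uv

    -- The half-routes end at the port of `(u , v)` in the first part and at that of `(v , u)` in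
    -- the second; the row of the former meets the column of the latter.
    across : ∀ {u v} → u ∈ S₁ → v ∈ S₂ → Adj u v →
             Route b L (λ d → d ≡ (u , v) ⊎ d ≡ (v , u)) (l₁.φ u) (l₂.φ v)
    across {u} {v} u∈ v∈ uv =
      lift₁ inj₁ (l₁.to-port u∈ (∈-++⁺ˡ v∈) uv) ◅◅
      bent-run (row₁∈ uv∈) (inj₁ refl) (col₂∈ vu∈) (inj₂ refl) (inside₁ (ports-in₁ uv∈)) (inside₂ (ports-in₂ vu∈)) ◅◅
      route-sym (lift₂ inj₂ (l₂.to-port v∈ (∈-++⁺ˡ u∈) (adj-sym uv)))
      where
      uv∈ : (u , v) ∈ D₁
      uv∈ = ∈-darts⁺ u∈ (∈-++⁺ˡ v∈) uv
      vu∈ : (v , u) ∈ D₂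
      vu∈ = ∈-darts⁺ v∈ (∈-++⁺ˡ u∈) (adj-sym uv)

    between : ∀ {u v} → u ∈ S → v ∈ S → Adj u v →
              Route b L (λ d → d ≡ (u , v) ⊎ d ≡ (v , u)) (φ u) (φ v)
    between {u} {v} u∈ v∈ uv with side u∈ | side v∈
    ... | first u∈₁ eqᵤ  | first v∈₁ eqᵥ  =
      subst₂ (Route b L _) (sym eqᵤ) (sym eqᵥ) (lift₁ id (l₁.between u∈₁ v∈₁ uv))
    ... | second u∈₂ eqᵤ | second v∈₂ eqᵥ =
      subst₂ (Route b L _) (sym eqᵤ) (sym eqᵥ) (lift₂ id (l₂.between u∈₂ v∈₂ uv))
    ... | first u∈₁ eqᵤ  | second v∈₂ eqᵥ =
      subst₂ (Route b L _) (sym eqᵤ) (sym eqᵥ) (across u∈₁ v∈₂ uv)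
    ... | second u∈₂ eqᵤ | first v∈₁ eqᵥ  =
      subst₂ (Route b L _) (sym eqᵤ) (sym eqᵥ)
        (route-mono id (λ _ _ → id) [ inj₂ , inj₁ ]′ (route-sym (across v∈₁ u∈₂ (adj-sym uv))))

    open ≤-Reasoning

    row-old : ∀ x y → length (old horizontal x y) ≤ load n y + Δ * hit n y
    row-old x y with x <? x₀ + w₁
    ... | yes _ = ≤-trans (l₁.row-load x y) (+-monoʳ-≤ (load n y) (row₁ y))
    ... | no _  = ≤-trans (l₂.row-load x y) (+-monoʳ-≤ (load n y) (row₂ y))

    col-old : ∀ x y → length (old vertical x y) ≤ load n x + Δ * hit n x
    col-old x y with x <? x₀ + w₁
    ... | yes _ = ≤-trans (l₁.col-load x y) (+-monoʳ-≤ (load n x) (col₁ x))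
    ... | no _  = ≤-trans (l₂.col-load x y) (+-monoʳ-≤ (load n x) (col₂ x))

    load-suc : ∀ x → load n x + Δ * hit n x + (Δ * hit n x + Δ * hit n x) ≡ load (suc n) x
    load-suc x = lemma (K * Δ) Δ (hits n x) (hit n x)
      where
      lemma : ∀ k d a b → k + 3 * (d * a) + d * b + (d * b + d * b) ≡ k + 3 * (d * (b + a))
      lemma = solve-∀

    row-load : ∀ x y → length (L horizontal x y) ≤ load (suc n) y + length (inRow port D y)
    row-load x y = begin
      length (old horizontal x y ++ inRow port₁ D₁ y ++ inRow port₂ D₂ y)
        ≡⟨ length-++ (old horizontal x y) ⟩
      length (old horizontal x y) + length (inRow port₁ D₁ y ++ inRow port₂ D₂ y)
        ≡⟨ cong (length (old horizontal x y) +_) (length-++ (inRow port₁ D₁ y)) ⟩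
      length (old horizontal x y) + (length (inRow port₁ D₁ y) + length (inRow port₂ D₂ y))
        ≤⟨ +-mono-≤ (row-old x y) (+-mono-≤ (row₁ y) (row₂ y)) ⟩
      load n y + Δ * hit n y + (Δ * hit n y + Δ * hit n y)
        ≡⟨ load-suc y ⟩
      load (suc n) y
        ≤⟨ m≤m+n _ _ ⟩
      load (suc n) y + length (inRow port D y) ∎

    col-load : ∀ x y → length (L vertical x y) ≤ load (suc n) x + length (inCol port D x)
    col-load x y = begin
      length (old vertical x y ++ inCol port D x ++ inCol port₁ D₁ x ++ inCol port₂ D₂ x)
        ≡⟨ length-++ (old vertical x y) ⟩
      o + length (inCol port D x ++ inCol port₁ D₁ x ++ inCol port₂ D₂ x)
        ≡⟨ cong (o +_) (length-++ (inCol port D x)) ⟩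
      o + (c + length (inCol port₁ D₁ x ++ inCol port₂ D₂ x))
        ≡⟨ cong (λ z → o + (c + z)) (length-++ (inCol port₁ D₁ x)) ⟩
      o + (c + (length (inCol port₁ D₁ x) + length (inCol port₂ D₂ x)))
        ≤⟨ +-mono-≤ (col-old x y) (+-monoʳ-≤ c (+-mono-≤ (col₁ x) (col₂ x))) ⟩
      load n x + Δ * hit n x + (c + (Δ * hit n x + Δ * hit n x))
        ≡⟨ lemma (load n x + Δ * hit n x) c _ ⟩
      load n x + Δ * hit n x + (Δ * hit n x + Δ * hit n x) + c
        ≡⟨ cong (_+ c) (load-suc x) ⟩
      load (suc n) x + c ∎
      where
      o = length (old vertical x y)
      c = length (inCol port D x)
      lemma : ∀ a b c → a + (b + c) ≡ a + c + b
      lemma = solve-∀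

    glue : Layout (suc n) b S Out port
    glue = record
      { φ = φ ; L = L ; φ-in = φ-in ; φ-inj = φ-inj ; to-port = to-port ; between = between
      ; row-load = row-load ; col-load = col-load }

-- Because `8 ≤ 9`, two separator rounds more than halve a set, so twice the binary logarithm of its
-- size suffices as depth in `order-exists`.
2^-*-3^ : ∀ {x} m → x ≤ 2 ^ m → x * 2 ^ (2 * m) ≤ 3 ^ (2 * m)
2^-*-3^ {x} m x≤ = begin
  x * 2 ^ (2 * m)        ≤⟨ *-monoˡ-≤ (2 ^ (2 * m)) x≤ ⟩
  2 ^ m * 2 ^ (2 * m)    ≡⟨ ^-distribˡ-+-* 2 m (2 * m) ⟨
  2 ^ (3 * m)            ≡⟨ ^-*-assoc 2 3 m ⟨
  8 ^ m                  ≤⟨ ^-monoˡ-≤ m (n≤1+n 8) ⟩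
  9 ^ m                  ≡⟨ ^-*-assoc 3 2 m ⟩
  3 ^ (2 * m)            ∎
  where open ≤-Reasoning

-- Port budgets and the recursion over regions

module Growth (t q n₀ : ℕ) .{{_ : NonZero q}} where

  -- `q` relates the sides polynomially. The factor 2 in `p` keeps the spacing `modulus (n / p)`
  -- near the square root of a shortest possible side. A base region has area at most
  -- `2 ^ (2 + n₀)`, and `K` doubles this for the darts inside and those leaving.
  τ p K : ℕ
  τ = suc t
  p = 2 * q
  K = 2 * 2 ^ (2 + n₀)

  instance
    p-nonZero : NonZero p
    p-nonZero = m*n≢0 2 q

  -- β n * Δ bounds the number of edges that leave the vertex set of a region of level n.
  -- It solves (2/3) β (n + 1) + 1 + 4 (n + 3) τ ≤ β n.
  β : ℕ → ℕ
  β n = 12 * τ * (6 + n)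

  β-step : ∀ n δ {x y} → 3 * x ≤ 2 * y + 3 * (δ + 2 * (2 * (3 + n) * (τ * δ))) →
           y ≤ β (suc n) * δ → x ≤ β n * δ
  β-step n δ {x} {y} x≤ y≤ = *-cancelˡ-≤ 3 (begin
    3 * x                                                                  ≤⟨ x≤ ⟩
    2 * y + 3 * (δ + 2 * (2 * (3 + n) * (τ * δ)))                          ≤⟨ +-monoˡ-≤ _ (*-monoʳ-≤ 2 y≤) ⟩
    2 * (12 * τ * (7 + n) * δ) + 3 * (δ + 2 * (2 * (3 + n) * (τ * δ)))     ≤⟨ m≤m+n _ (9 * δ + 12 * (t * δ)) ⟩
    2 * (12 * τ * (7 + n) * δ) + 3 * (δ + 2 * (2 * (3 + n) * (τ * δ))) + (9 * δ + 12 * (t * δ))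
                                                                           ≡⟨ lemma t n δ ⟩
    3 * (12 * τ * (6 + n) * δ)                                             ∎)
    where
    open ≤-Reasoning
    lemma : ∀ t n δ → 2 * (12 * (1 + t) * (7 + n) * δ) + 3 * (δ + 2 * (2 * (3 + n) * ((1 + t) * δ))) + (9 * δ + 12 * (t * δ))
                      ≡ 3 * (12 * (1 + t) * (6 + n) * δ)
    lemma = solve-∀

  -- From level `n₀` on, any side that a region of level `n` can have is crossed by `β n` lines
  -- reserved for that level; the successor pays for the block lost in `line`.
  Roomy : Set
  Roomy = ∀ n i → n₀ ≤ n → n ≤ q * suc i → Marks.modulus (n / p) * suc (β n) ≤ 2 ^ i

  module _ (roomy : Roomy) (G : Graph)
    (separation : (S : List (Graph.Vertex G)) → Unique S → 1 ≤ length S → Separation G τ S) where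

    open Graph G using (Vertex; Adj)
    open Count G
    open Layouts G p K
    open Marks using (line; line<; line≥; count-line)
    open Marks.Hits p
    open Bisect G τ separation

    -- The exponents `i` and `j` describe the sides up to a factor 2. The upper bounds are not
    -- strict because a half that is rounded up can be exactly a power of two. `n≤i` and `n≤j` keep
    -- the sides polynomially related.
    record Task (n i j : ℕ) (b : Box) (S Out : List Vertex) (port : Ports) : Set where
      open Box b
      field
        i+j≡n    : i + j ≡ n
        width≥   : 2 ^ i ≤ width
        width≤   : width ≤ 2 ^ suc i
        height≥  : 2 ^ j ≤ height
        height≤  : height ≤ 2 ^ suc j
        n≤i      : n ≤ q * suc i
        n≤j      : n ≤ q * suc j
        unique   : Unique (S ++ Out)
        fits     : length S ≤ width * height
        ext≤     : e S Out ≤ β n * Δ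
        ports-in : ∀ {d} → d ∈ darts S Out → Inside b (port d)

    transposeT : ∀ {n i j b S Out port} → Task n i j b S Out port →
                 Task n j i (transposeBox b) S Out (transpose ∘ port)
    transposeT {i = i} {j} {b} {S} T = record
      { i+j≡n = trans (+-comm j i) i+j≡n ; width≥ = height≥ ; width≤ = height≤
      ; height≥ = width≥ ; height≤ = width≤ ; n≤i = n≤j ; n≤j = n≤i ; unique = unique
      ; fits = subst (length S ≤_) (*-comm (Box.width b) (Box.height b)) fits
      ; ext≤ = ext≤ ; ports-in = inside-transpose ∘ ports-in }
      where open Task T

    area≤ : ∀ {n i j b S Out port} → Task n i j b S Out port → length S ≤ 2 ^ (2 + n)
    area≤ {n} {i} {j} {b} {S} T = begin
      length S                         ≤⟨ fits ⟩
      Box.width b * Box.height b       ≤⟨ *-mono-≤ width≤ height≤ ⟩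
      2 ^ suc i * 2 ^ suc j            ≡⟨ ^-distribˡ-+-* 2 (suc i) (suc j) ⟨
      2 ^ (suc i + suc j)              ≡⟨ cong (λ k → 2 ^ suc k) (trans (+-suc i j) (cong suc i+j≡n)) ⟩
      2 ^ (2 + n)                      ∎
      where
      open Task T
      open ≤-Reasoning

    record ChildPorts (n : ℕ) (b : Box) (ds : List Dart) : Set where
      field
        port     : Ports
        ports-in : ∀ {d} → d ∈ ds → Inside b (port d)
        rows     : ∀ y → length (inRow port ds y) ≤ Δ * hit n y
        cols     : ∀ x → length (inCol port ds x) ≤ Δ * hit n x

    -- One slot determines both coordinates of a port, so the same at most `Δ` darts share its row
    -- and its column.
    child-ports : ∀ n x₀ w y₀ h S Out → Unique (S ++ Out) → e S Out ≤ β n * Δ →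
      Marks.modulus (n / p) * suc (β n) ≤ w → Marks.modulus (n / p) * suc (β n) ≤ h →
      ChildPorts n (box x₀ w y₀ h) (darts S Out)
    child-ports n x₀ w y₀ h S Out u ext≤ w-fits h-fits =
      let uS , uOut , _ = Unique-++⁻ S u
          uD = Unique-darts uS uOut
          g , g< , count = assign _≟ᴰ_ (β n) Δ (darts S Out) uD
            (subst (_≤ β n * Δ) (sym (length-darts S Out)) ext≤)
      in record
        { port = λ d → line (n / p) x₀ (g d) , line (n / p) y₀ (g d)
        ; ports-in = λ {d} d∈ → inside (line≥ (n / p) x₀ (g d)) (line< (n / p) x₀ (g d) (g< d∈) w-fits)
                                       (line≥ (n / p) y₀ (g d)) (line< (n / p) y₀ (g d) (g< d∈) h-fits)
        ; rows = λ y → count-line p uD g count n y₀ y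
        ; cols = λ x → count-line p uD g count n x₀ x
        }

    LayoutsAt : ℕ → Set
    LayoutsAt n = ∀ i j b S Out port → Task n i j b S Out port → Layout n b S Out port

    split-width : ∀ n → n₀ ≤ n → 2 ≤ q → LayoutsAt n → ∀ i j b S Out port → j ≤ suc i →
                  Task (suc n) (suc i) j b S Out port → Layout (suc n) b S Out port
    split-width n n₀≤n 2≤q rec i j (box x₀ w y₀ h) S Out port j≤ T =
      subst (λ w → Layout (suc n) (box x₀ w y₀ h) S Out port) w₁+w₂≡w
        (Glue.glue perm (λ d∈ → subst (λ w → Inside (box x₀ w y₀ h) (port _)) (sym w₁+w₂≡w) (ports-in d∈))
          P₁.ports-in P₂.ports-in P₁.rows P₂.rows P₁.cols P₂.cols
          (rec i j _ S₁ (S₂ ++ Out) P₁.port (record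
            { i+j≡n = i+j≡ ; width≥ = w₁≥ ; width≤ = ≤-trans (⌊n/2⌋≤⌈n/2⌉ w) w₂≤ ; height≥ = height≥ ; height≤ = height≤
            ; n≤i = n≤i′ ; n≤j = n≤j′ ; unique = u₁ ; fits = S₁≤ ; ext≤ = ext₁ ; ports-in = P₁.ports-in }))
          (rec i j _ S₂ (S₁ ++ Out) P₂.port (record
            { i+j≡n = i+j≡ ; width≥ = ≤-trans w₁≥ (⌊n/2⌋≤⌈n/2⌉ w) ; width≤ = w₂≤ ; height≥ = height≥ ; height≤ = height≤
            ; n≤i = n≤i′ ; n≤j = n≤j′ ; unique = u₂ ; fits = S₂≤ ; ext≤ = ext₂ ; ports-in = P₂.ports-in })))
      where
      open Task T
      open ≤-Reasoning
      w₁ w₂ : ℕ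
      w₁ = ⌊ w /2⌋
      w₂ = ⌈ w /2⌉
      w₁+w₂≡w : w₁ + w₂ ≡ w
      w₁+w₂≡w = ⌊n/2⌋+⌈n/2⌉≡n w
      double : ∀ x → 2 * x ≡ x + x
      double x = cong (x +_) (+-identityʳ x)
      i+j≡ : i + j ≡ n
      i+j≡ = suc-injective i+j≡n
      w₁≥ : 2 ^ i ≤ w₁
      w₁≥ = ≤-trans (≤-reflexive (trans (n≡⌊n+n/2⌋ (2 ^ i)) (cong ⌊_/2⌋ (sym (double (2 ^ i)))))) (⌊n/2⌋-mono width≥)
      w₂≤ : w₂ ≤ 2 ^ suc i
      w₂≤ = ≤-trans (⌈n/2⌉-mono width≤)
        (≤-reflexive (sym (trans (n≡⌈n+n/2⌉ (2 ^ suc i)) (cong ⌈_/2⌉ (sym (double (2 ^ suc i)))))))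
      w₂≤2w₁ : w₂ ≤ w₁ + w₁
      w₂≤2w₁ = ≤-trans (⌊n/2⌋-mono (n≤1+n (suc w))) (+-monoˡ-≤ w₁ (≤-trans (m^n>0 2 i) w₁≥))
      n≤j′ : n ≤ q * suc j
      n≤j′ = ≤-trans (n≤1+n n) n≤j
      -- The halved side was the longer one, so `suc i` is still at least about half of `n`, and
      -- `2 ≤ q` suffices.
      n≤i′ : n ≤ q * suc i
      n≤i′ = begin
        n               ≡⟨ i+j≡ ⟨
        i + j           ≤⟨ +-mono-≤ (n≤1+n i) j≤ ⟩
        suc i + suc i   ≡⟨ double (suc i) ⟨
        2 * suc i       ≤⟨ *-monoˡ-≤ (suc i) 2≤q ⟩
        q * suc i       ∎
      -- The region of level `suc n` has area at most `2 ^ (3 + n)`, which gives the depth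
      -- `2 * (3 + n)`.
      halved : Bisection G S Out (w₁ * h) (w₂ * h) (2 * (3 + n) * (τ * Δ))
      halved = bisect S Out (w₁ * h) (w₂ * h) (2 * (3 + n))
        (proj₁ (Unique-++⁻ S unique)) (proj₁ (proj₂ (Unique-++⁻ S unique)))
        (subst (length S ≤_) (trans (cong (_* h) (sym w₁+w₂≡w)) (*-distribʳ-+ h w₁ w₂)) fits)
        (*-monoˡ-≤ h (⌊n/2⌋≤⌈n/2⌉ w))
        (subst (w₂ * h ≤_) (*-distribʳ-+ h w₁ w₁) (*-monoˡ-≤ h w₂≤2w₁))
        (2^-*-3^ (3 + n) (area≤ T))
      open Bisection halved
      u₁ : Unique (S₁ ++ S₂ ++ Out)
      u₁ = subst Unique (++-assoc S₁ S₂ Out) (Unique-resp-↭ (++⁺ʳ Out (↭-sym perm)) unique)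
      u₂ : Unique (S₂ ++ S₁ ++ Out)
      u₂ = Unique-resp-↭ (shifts S₁ S₂) u₁
      ext₁ : e S₁ (S₂ ++ Out) ≤ β n * Δ
      ext₁ = β-step n Δ ext₁≤ ext≤
      ext₂ : e S₂ (S₁ ++ Out) ≤ β n * Δ
      ext₂ = β-step n Δ ext₂≤ ext≤
      room-w : Marks.modulus (n / p) * suc (β n) ≤ w₁
      room-w = ≤-trans (roomy n i n₀≤n n≤i′) w₁≥
      room-h : Marks.modulus (n / p) * suc (β n) ≤ h
      room-h = ≤-trans (roomy n j n₀≤n n≤j′) height≥
      ports₁ : ChildPorts n (box x₀ w₁ y₀ h) (darts S₁ (S₂ ++ Out))
      ports₁ = child-ports n x₀ w₁ y₀ h S₁ (S₂ ++ Out) u₁ ext₁ room-w room-h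
      ports₂ : ChildPorts n (box (x₀ + w₁) w₂ y₀ h) (darts S₂ (S₁ ++ Out))
      ports₂ = child-ports n (x₀ + w₁) w₂ y₀ h S₂ (S₁ ++ Out) u₂ ext₂ (≤-trans room-w (⌊n/2⌋≤⌈n/2⌉ w)) room-h
      module P₁ = ChildPorts ports₁
      module P₂ = ChildPorts ports₂

    layouts : 2 ≤ q → ∀ n → LayoutsAt n
    layouts 2≤q n i j (box x₀ w y₀ h) S Out port T with n ≤? n₀
    ... | yes n≤n₀ = small-layout n x₀ w y₀ h S Out port {{>-nonZero (≤-trans (m^n>0 2 i) width≥)}}
        (proj₁ (Unique-++⁻ S unique)) (proj₁ (proj₂ (Unique-++⁻ S unique))) fits
        (*-monoʳ-≤ 2 (≤-trans (area≤ T) (^-monoʳ-≤ 2 (+-monoʳ-≤ 2 n≤n₀)))) ports-in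
      where open Task T
    layouts 2≤q zero i j b S Out port T | no n≰ = contradiction z≤n n≰
    layouts 2≤q (suc n) i j b@(box _ _ _ _) S Out port T | no n≰ with ≤-total j i
    layouts 2≤q (suc n) (suc i) j b@(box _ _ _ _) S Out port T | no n≰ | inj₁ j≤i =
      split-width n (s≤s⁻¹ (≰⇒> n≰)) 2≤q (layouts 2≤q n) i j b S Out port j≤i T
    layouts 2≤q (suc n) zero zero b@(box _ _ _ _) S Out port T | no n≰ | inj₁ z≤n with () ← Task.i+j≡n T
    layouts 2≤q (suc n) i (suc j) b@(box _ _ _ _) S Out port T | no n≰ | inj₂ i≤j =
      transposeL (split-width n (s≤s⁻¹ (≰⇒> n≰)) 2≤q (layouts 2≤q n) j i (transposeBox b) S Out (transpose ∘ port) i≤j (transposeT T))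
    layouts 2≤q (suc n) zero zero b@(box _ _ _ _) S Out port T | no n≰ | inj₂ z≤n with () ← Task.i+j≡n T

    -- Here the number of levels disappears from the bound, since at most `p` of them reserve the
    -- same line.
    load≤ : ∀ n x → load n x ≤ (K + 3 * p) * Δ
    load≤ n x = begin
      K * Δ + 3 * (Δ * hits n x)   ≤⟨ +-monoʳ-≤ (K * Δ) (*-monoʳ-≤ 3 (*-monoʳ-≤ Δ (hits≤ n x))) ⟩
      K * Δ + 3 * (Δ * p)          ≡⟨ lemma K Δ p ⟩
      (K + 3 * p) * Δ              ∎
      where
      open ≤-Reasoning
      lemma : ∀ k d p → k * d + 3 * (d * p) ≡ (k + 3 * p) * d
      lemma = solve-∀

-- Exponential sides against linear port budgets

n<2^n : ∀ n → n < 2 ^ n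
n<2^n zero    = s≤s z≤n
n<2^n (suc n) = begin
  suc (suc n)      ≤⟨ +-mono-≤ (m^n>0 2 n) (n<2^n n) ⟩
  2 ^ n + 2 ^ n    ≡⟨ cong (2 ^ n +_) (+-identityʳ (2 ^ n)) ⟨
  2 ^ suc n        ∎
  where open ≤-Reasoning

linear≤2^ : ∀ c → ∃[ m₀ ] (∀ m → m₀ ≤ m → c * suc m ≤ 2 ^ m)
linear≤2^ c = m₀ , λ m m₀≤m → subst (λ m → c * suc m ≤ 2 ^ m) (m+[n∸m]≡n m₀≤m) (bound (m ∸ m₀))
  where
  open ≤-Reasoning
  m₀ : ℕ
  -- The exponent is split so that `2 ^ c` pays for the factor `c` and `2 ^ (2 + (c + k))`, at least
  -- `4 * suc (c + k)`, pays for the linear term.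
  m₀ = c + (2 + c)
  bound : ∀ k → c * suc (m₀ + k) ≤ 2 ^ (m₀ + k)
  bound k = begin
    c * suc (m₀ + k)                ≤⟨ *-mono-≤ (<⇒≤ (n<2^n c)) (begin
      suc (c + (2 + c) + k)           ≤⟨ m≤m+n _ (1 + c + c + 3 * k) ⟩
      suc (c + (2 + c) + k) + (1 + c + c + 3 * k) ≡⟨ lemma c k ⟩
      4 * suc (c + k)                 ≤⟨ *-monoʳ-≤ 4 (n<2^n (c + k)) ⟩
      4 * 2 ^ (c + k)                 ≡⟨ ^-distribˡ-+-* 2 2 (c + k) ⟨
      2 ^ (2 + (c + k))               ∎) ⟩
    2 ^ c * 2 ^ (2 + (c + k))       ≡⟨ ^-distribˡ-+-* 2 c (2 + (c + k)) ⟨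
    2 ^ (c + (2 + (c + k)))         ≡⟨ cong (2 ^_) (+-assoc c (2 + c) k) ⟨
    2 ^ (m₀ + k)                    ∎
    where
    lemma : ∀ c k → suc (c + (2 + c) + k) + (1 + c + c + 3 * k) ≡ 4 * suc (c + k)
    lemma = solve-∀

-- With `r = n / p`, the relation `n ≤ q * suc i` gives `r + r ≤ suc i`. One factor `2 ^ r` of the
-- side is consumed by the modulus, the other one dominates the budget, which is linear in `r`; the
-- choice of `n₀` makes `r` reach the threshold of `linear≤2^`.
roomy-exists : ∀ t q .{{_ : NonZero q}} → ∃[ n₀ ] Growth.Roomy t q n₀
roomy-exists t q = p * m₀ , roomy
  where
  open ≤-Reasoning
  p c m₀ : ℕ
  p = 2 * q
  -- The budget with its successor is at most a quarter of `c * suc r`. The factor 4 makes up for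
  -- the 2 in the modulus and for `suc i` in place of `i`.
  c = 4 * (1 + 12 * suc t * (6 + p))
  m₀ = proj₁ (linear≤2^ c)
  instance
    p-nonZero : NonZero p
    p-nonZero = m*n≢0 2 q
  roomy : Growth.Roomy t q (p * m₀)
  roomy n i pm₀≤n n≤ = *-cancelˡ-≤ 4 (begin
    4 * (Marks.modulus r * suc (12 * suc t * (6 + n)))
      ≤⟨ *-monoʳ-≤ 4 (*-monoʳ-≤ (Marks.modulus r) (s≤s (*-monoʳ-≤ (12 * suc t) (+-monoʳ-≤ 6 n≤p)))) ⟩
    4 * (Marks.modulus r * suc (12 * suc t * (6 + suc r * p)))
      ≤⟨ m≤m+n _ (4 * (Marks.modulus r * (r + 72 * suc t * r))) ⟩
    4 * (Marks.modulus r * suc (12 * suc t * (6 + suc r * p))) + 4 * (Marks.modulus r * (r + 72 * suc t * r))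
      ≡⟨ lemma (Marks.modulus r) t p r ⟩
    Marks.modulus r * (c * suc r)
      ≤⟨ *-monoʳ-≤ (Marks.modulus r) (proj₂ (linear≤2^ c) r m₀≤r) ⟩
    Marks.modulus r * 2 ^ r
      ≡⟨ cong (_* 2 ^ r) (Marks.modulus≡ r) ⟩
    2 * 2 ^ r * 2 ^ r
      ≡⟨ *-assoc 2 (2 ^ r) (2 ^ r) ⟩
    2 * (2 ^ r * 2 ^ r)
      ≡⟨ cong (2 *_) (^-distribˡ-+-* 2 r r) ⟨
    2 * 2 ^ (r + r)
      ≤⟨ *-monoʳ-≤ 2 (^-monoʳ-≤ 2 2r≤) ⟩
    2 * 2 ^ suc i
      ≡⟨ *-assoc 2 2 (2 ^ i) ⟨
    4 * 2 ^ i ∎)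
    where
    r : ℕ
    r = n / p
    n≤p : n ≤ suc r * p
    n≤p = ≤-trans (≤-reflexive (m≡m%n+[m/n]*n n p)) (+-monoˡ-≤ (r * p) (<⇒≤ (m%n<n n p)))
    m₀≤r : m₀ ≤ r
    m₀≤r = ≤-trans (≤-reflexive (sym (m*n/n≡m m₀ p))) (/-monoˡ-≤ p (≤-trans (≤-reflexive (*-comm m₀ p)) pm₀≤n))
    2r≤ : r + r ≤ suc i
    2r≤ = *-cancelˡ-≤ q (begin
      q * (r + r)     ≡⟨ lemma′ q r ⟩
      r * p           ≤⟨ m/n*n≤m n p ⟩
      n               ≤⟨ n≤ ⟩
      q * suc i       ∎)
      where
      lemma′ : ∀ q r → q * (r + r) ≡ r * (2 * q)
      lemma′ = solve-∀
    lemma : ∀ m t p r → 4 * (m * (1 + 12 * (1 + t) * (6 + (1 + r) * p))) + 4 * (m * (r + 72 * (1 + t) * r))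
            ≡ m * (4 * (1 + 12 * (1 + t) * (6 + p)) * (1 + r))
    lemma = solve-∀

-- Hamiltonian paths of grids

GridAdj-∷ˡ : ∀ {d k} {ℓ : Vec ℕ d} (i : Fin k) {xs ys : Node ℓ} → GridAdj xs ys →
             GridAdj {ℓ = k ∷ ℓ} (i ∷ xs) (i ∷ ys)
GridAdj-∷ˡ i (j , diff , same) = suc j , diff , λ where
  zero    _  → refl
  (suc k) k≢ → same k (k≢ ∘ cong suc)

GridAdj-∷ʳ : ∀ {d k} {ℓ : Vec ℕ d} {i j : Fin k} (xs : Node ℓ) → ∣ toℕ i - toℕ j ∣ ≡ 1 →
             GridAdj {ℓ = k ∷ ℓ} (i ∷ xs) (j ∷ xs)
GridAdj-∷ʳ xs diff = zero , diff , λ where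
  zero    0≢ → contradiction refl 0≢
  (suc k) _  → refl

Linked-tabulate : ∀ {A : Set} {R : A → A → Set} {n} (f : Fin n → A) →
                  (∀ {i j} → toℕ j ≡ suc (toℕ i) → R (f i) (f j)) → Linked R (tabulate f)
Linked-tabulate {n = zero}        f r = []
Linked-tabulate {n = suc zero}    f r = [-]
Linked-tabulate {n = suc (suc n)} f r = r refl ∷ Linked-tabulate (f ∘ suc) (r ∘ cong suc)

Linked-reverse : ∀ {A : Set} {R : A → A → Set} → (∀ {x y} → R x y → R y x) →
                 ∀ {xs} → Linked R xs → Linked R (reverse xs)
Linked-reverse R-sym {[]}          _       = []
Linked-reverse R-sym {x ∷ []}      _       = [-]
Linked-reverse {R = R} R-sym {x ∷ y ∷ xs} (r ∷ l) = subst (Linked R) (sym (unfold-reverse x (y ∷ xs)))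
  (Linkedₚ.++⁺ (Linked-reverse R-sym l)
    (subst (λ m → Connected R m (just x))
      (sym (trans (cong last (unfold-reverse y xs)) (last-∷ʳ (reverse xs) y))) (just (R-sym r)))
    [-])

Linked-lookup : ∀ {A : Set} {R : A → A → Set} {xs} → Linked R xs →
                ∀ {i j} → toℕ j ≡ suc (toℕ i) → R (List.lookup xs i) (List.lookup xs j)
Linked-lookup (r ∷ l) {zero}  {suc zero} _  = r
Linked-lookup (r ∷ l) {suc i} {suc j}    eq = Linked-lookup l (suc-injective eq)
Linked-lookup [-]     {zero}  {zero}     ()

lookup-injective : ∀ {A : Set} {xs : List A} → Unique xs → ∀ {i j} → List.lookup xs i ≡ List.lookup xs j → i ≡ j
lookup-injective (x∉ ∷ u) {zero}  {zero}  eq = refl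
lookup-injective {xs = _ ∷ xs} (x∉ ∷ u) {zero}  {suc j} eq = contradiction eq (All.lookup x∉ (∈-lookup j))
lookup-injective {xs = _ ∷ xs} (x∉ ∷ u) {suc i} {zero}  eq = contradiction (sym eq) (All.lookup x∉ (∈-lookup i))
lookup-injective (x∉ ∷ u) {suc i} {suc j} eq = cong suc (lookup-injective u eq)

-- Boustrophedon order: every second row is traversed backwards, so consecutive rows meet at the
-- same tail and only the first coordinate changes there.
snakeRows : ∀ {d k} {ℓ : Vec ℕ d} → List (Fin k) → List (Node ℓ) → List (Node (k ∷ ℓ))
snakeRows []       P = []
snakeRows (i ∷ is) P = map (i ∷_) P ++ snakeRows is (reverse P)

snake : ∀ {d} (ℓ : Vec ℕ d) → List (Node ℓ)
snake []      = [] ∷ []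
snake (k ∷ ℓ) = snakeRows (allFin k) (snake ℓ)

module _ {d k : ℕ} {ℓ : Vec ℕ d} where

  length-snakeRows : ∀ (is : List (Fin k)) (P : List (Node ℓ)) → length (snakeRows is P) ≡ length is * length P
  length-snakeRows []       P = refl
  length-snakeRows (i ∷ is) P = trans (length-++ (map (i ∷_) P))
    (cong₂ _+_ (length-map (i ∷_) P)
      (trans (length-snakeRows is (reverse P)) (cong (length is *_) (length-reverse P))))

  head∈ : ∀ (is : List (Fin k)) (P : List (Node ℓ)) {i xs} → i ∷ xs ∈ snakeRows is P → i ∈ is
  head∈ (i ∷ is) P x∈ with ∈-++⁻ (map (i ∷_) P) x∈
  ... | inj₂ x∈′ = there (head∈ is (reverse P) x∈′)
  ... | inj₁ x∈′ with ∈-map⁻ (i ∷_) x∈′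
  ...   | _ , _ , refl = here refl

  Unique-snakeRows : ∀ {is : List (Fin k)} {P : List (Node ℓ)} → Unique is → Unique P → Unique (snakeRows is P)
  Unique-snakeRows                   []        uP = []
  Unique-snakeRows {i ∷ is} {P} (i∉ ∷ u) uP = Unique.++⁺
    (Unique.map⁺ (λ { refl → refl }) uP)
    (Unique-snakeRows u (Unique-resp-↭ (↭-sym (↭-reverse P)) uP)) disjoint
    where
    disjoint : ∀ {x} → ¬ (x ∈ map (i ∷_) P × x ∈ snakeRows is (reverse P))
    disjoint (x∈ , x∈′) with ∈-map⁻ (i ∷_) x∈
    ... | _ , _ , refl = All.lookup i∉ (head∈ is (reverse P) x∈′) refl

  Adjᴳ : Node (k ∷ ℓ) → Node (k ∷ ℓ) → Set
  Adjᴳ = GridAdj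

  Linked-snakeRows : ∀ {is : List (Fin k)} {P : List (Node ℓ)} →
    Linked (λ i j → ∣ toℕ i - toℕ j ∣ ≡ 1) is → Linked GridAdj P → Linked Adjᴳ (snakeRows is P)
  Linked-snakeRows {[]}     _  lP = []
  Linked-snakeRows {i ∷ is} {P} li lP = Linkedₚ.++⁺
    (Linkedₚ.map⁺ (Linked.map (λ {x} {y} → GridAdj-∷ˡ i {x} {y}) lP)) (connected li (initLast P))
    (Linked-snakeRows (Linked.tail li) (Linked-reverse (λ {x} {y} → gridAdj-sym {x = x} {y}) lP))
    where
    connected : ∀ {is} → Linked (λ i j → ∣ toℕ i - toℕ j ∣ ≡ 1) (i ∷ is) → InitLast P →
                Connected Adjᴳ (last (map (i ∷_) P)) (head (snakeRows is (reverse P)))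
    connected {is} _ InitLast.[] = empty is
      where
      empty : ∀ is → Connected Adjᴳ (last []) (head (snakeRows is []))
      empty []       = nothing
      empty (_ ∷ is) = empty is
    connected {[]} _ (Q ∷ʳ′ x) = subst (λ m → Connected Adjᴳ m _) (sym (last-row x)) just-nothing
      where
      last-row : ∀ x → last (map (i ∷_) (Q ++ x ∷ [])) ≡ just (i ∷ x)
      last-row x = trans (cong last (map-++ (i ∷_) Q (x ∷ []))) (last-∷ʳ (map (i ∷_) Q) (i ∷ x))
    connected {j ∷ js} (r ∷ _) (Q ∷ʳ′ x) = subst₂ (Connected Adjᴳ) (sym last-row) (sym head-rows) (just (GridAdj-∷ʳ x r))
      where
      last-row : last (map (i ∷_) (Q ++ x ∷ [])) ≡ just (i ∷ x)
      last-row = trans (cong last (map-++ (i ∷_) Q (x ∷ []))) (last-∷ʳ (map (i ∷_) Q) (i ∷ x))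
      head-rows : head (snakeRows (j ∷ js) (reverse (Q ++ x ∷ []))) ≡ just (j ∷ x)
      head-rows = cong (λ R → head (map (j ∷_) R ++ snakeRows js (reverse R))) (reverse-++ Q (x ∷ []))

length-snake : ∀ {d} (ℓ : Vec ℕ d) → length (snake ℓ) ≡ length (nodes ℓ)
length-snake []      = refl
length-snake (k ∷ ℓ) = trans (length-snakeRows (allFin k) (snake ℓ))
  (trans (cong (length (allFin k) *_) (length-snake ℓ)) (sym (length-cartesianProductWith′ (allFin k) (nodes ℓ))))
  where
  length-cartesianProductWith′ : ∀ (is : List (Fin k)) (P : List (Node ℓ)) →
    length (cartesianProductWith {C = Node (k ∷ ℓ)} _∷_ is P) ≡ length is * length P
  length-cartesianProductWith′ []       P = refl
  length-cartesianProductWith′ (i ∷ is) P = trans (length-++ (map (i ∷_) P))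
    (cong₂ _+_ (length-map (i ∷_) P) (length-cartesianProductWith′ is P))

Unique-snake : ∀ {d} (ℓ : Vec ℕ d) → Unique (snake ℓ)
Unique-snake []      = [] ∷ []
Unique-snake (k ∷ ℓ) = Unique-snakeRows (Unique.allFin⁺ k) (Unique-snake ℓ)

Linked-snake : ∀ {d} (ℓ : Vec ℕ d) → Linked GridAdj (snake ℓ)
Linked-snake []      = [-]
Linked-snake (k ∷ ℓ) = Linked-snakeRows
  (Linked-tabulate id λ {i} {j} eq → trans (cong (∣ toℕ i -_∣) eq) (trans (m≤n⇒∣m-n∣≡n∸m (n≤1+n (toℕ i))) (m+n∸n≡m 1 (toℕ i))))
  (Linked-snake ℓ)

-- A Hamiltonian path of the last d dimensions makes a two-dimensional grid a spanning subgraph of the grid.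
module Plane {d : ℕ} (a : ℕ) (ℓ : Vec ℕ d) .{{_ : NonZero a}} .{{_ : NonZero (length (snake ℓ))}} where

  B : ℕ
  B = length (snake ℓ)

  -- The remainders only make `ψ` total; inside `plane` they change nothing.
  ψ : Point → Node (a ∷ ℓ)
  ψ (x , y) = fromℕ< (m%n<n x a) ∷ List.lookup (snake ℓ) (fromℕ< (m%n<n y B))

  plane : Box
  plane = box 0 a 0 B

  toℕ-x : ∀ {x} → x < a → toℕ (fromℕ< (m%n<n x a)) ≡ x
  toℕ-x {x} x<a = trans (toℕ-fromℕ< (m%n<n x a)) (m<n⇒m%n≡m x<a)

  toℕ-y : ∀ {y} → y < B → toℕ (fromℕ< (m%n<n y B)) ≡ y
  toℕ-y {y} y<B = trans (toℕ-fromℕ< (m%n<n y B)) (m<n⇒m%n≡m y<B)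

  ψ-injective : ∀ {p q} → Inside plane p → Inside plane q → ψ p ≡ ψ q → p ≡ q
  ψ-injective {x , y} {x′ , y′} i j eq = cong₂ _,_
    (trans (sym (toℕ-x (Inside.x< i))) (trans (cong toℕ (cong (λ { (z ∷ _) → z }) eq)) (toℕ-x (Inside.x< j))))
    (trans (sym (toℕ-y (Inside.y< i))) (trans (cong toℕ (lookup-injective (Unique-snake ℓ)
      (cong (λ { (_ ∷ zs) → zs }) eq))) (toℕ-y (Inside.y< j))))

  ψ-east : ∀ {x y} → Inside plane (x , y) → Inside plane (suc x , y) → GridAdj (ψ (x , y)) (ψ (suc x , y))
  ψ-east {x} {y} i j = GridAdj-∷ʳ (List.lookup (snake ℓ) (fromℕ< (m%n<n y B)))
    (trans (cong₂ ∣_-_∣ (toℕ-x (Inside.x< i)) (toℕ-x (Inside.x< j)))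
      (trans (m≤n⇒∣m-n∣≡n∸m (n≤1+n x)) (m+n∸n≡m 1 x)))

  ψ-north : ∀ {x y} → Inside plane (x , y) → Inside plane (x , suc y) → GridAdj (ψ (x , y)) (ψ (x , suc y))
  ψ-north {x} {y} i j = GridAdj-∷ˡ (fromℕ< (m%n<n x a))
    {List.lookup (snake ℓ) (fromℕ< (m%n<n y B))} {List.lookup (snake ℓ) (fromℕ< (m%n<n (suc y) B))}
    (Linked-lookup (Linked-snake ℓ)
      (trans (toℕ-y (Inside.y< j)) (cong suc (sym (toℕ-y (Inside.y< i))))))

-- Shortening routes to simple paths

module LoopErasure {A : Set} (_≟ᴬ_ : DecidableEquality A) {R : A → A → Set} where

  open DecMembership _≟ᴬ_ using (_∈?_)

  record SimplePath (x y : A) : Set where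
    field
      path     : List A
      starts   : head path ≡ just x
      ends     : last path ≡ just y
      linked   : Linked R path
      distinct : Unique path

  last-++ : ∀ (xs : List A) {y ys} → last (xs ++ y ∷ ys) ≡ last (y ∷ ys)
  last-++ []           = refl
  last-++ (x ∷ [])     = refl
  last-++ (x ∷ z ∷ xs) = last-++ (z ∷ xs)

  Linked-++⁻ʳ : ∀ (xs : List A) {ys} → Linked R (xs ++ ys) → Linked R ys
  Linked-++⁻ʳ []       l = l
  Linked-++⁻ʳ (x ∷ xs) l = Linked-++⁻ʳ xs (Linked.tail l)

  -- If `x` occurs on the path already, the closed detour up to that occurrence is dropped. Steps
  -- are only removed or added with a given witness, so each step of the result still satisfies `R`
  -- and keeps any label that `R` records.
  extend : ∀ {x y z} → R x y → SimplePath y z → SimplePath x z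
  extend r record { path = [] ; starts = () }
  extend {x} r record { path = y ∷ ws ; starts = refl ; ends = ends ; linked = li ; distinct = un }
    with x ∈? (y ∷ ws)
  ... | no x∉ = record
    { path = x ∷ y ∷ ws ; starts = refl ; ends = ends ; linked = r ∷ li ; distinct = Allₚ.¬Any⇒All¬ _ x∉ ∷ un }
  ... | yes x∈ with ∈-∃++ x∈
  ...   | as , bs , eq = record
    { path = x ∷ bs ; starts = refl
    ; ends = trans (sym (last-++ as)) (trans (cong last (sym eq)) ends)
    ; linked = Linked-++⁻ʳ as (subst (Linked R) eq li)
    ; distinct = proj₁ (proj₂ (Unique-++⁻ as (subst Unique eq un))) }

  erase-loops : ∀ {x y} → Star R x y → SimplePath x y
  erase-loops {x} ε = record
    { path = x ∷ [] ; starts = refl ; ends = refl ; linked = [-] ; distinct = [] ∷ [] }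
  erase-loops (r ◅ rs) = extend r (erase-loops rs)

-- The embedding into the grid and its congestion

Linked-steps : ∀ {A : Set} {R : A → A → Set} {ws} → Linked R ws → ∀ {x y} → (x , y) ∈ steps ws → R x y
Linked-steps (r ∷ l) (here refl) = r
Linked-steps (r ∷ l) (there s)   = Linked-steps l s

∈-pairs⁻ : ∀ {A : Set} (xs : List A) {x y} → (x , y) ∈ pairs xs → x ∈ xs
∈-pairs⁻ (z ∷ xs) xy∈ with ∈-++⁻ (map (z ,_) xs) xy∈
... | inj₂ xy∈′ = there (∈-pairs⁻ xs xy∈′)
... | inj₁ xy∈′ with ∈-map⁻ (z ,_) xy∈′
...   | _ , _ , refl = here refl

Unique-pairs : ∀ {A : Set} {xs : List A} → Unique xs → Unique (pairs xs)
Unique-pairs []               = []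
Unique-pairs {xs = x ∷ xs} (x∉ ∷ u) = Unique.++⁺ (Unique.map⁺ (λ { refl → refl }) u) (Unique-pairs u) disjoint
  where
  disjoint : ∀ {p} → ¬ (p ∈ map (x ,_) xs × p ∈ pairs xs)
  disjoint (p∈ , p∈′) with ∈-map⁻ (x ,_) p∈
  ... | _ , _ , refl = All.lookup x∉ (∈-pairs⁻ xs p∈′) refl

module Congestion (G : Graph) {d : ℕ} (a : ℕ) (ℓ : Vec ℕ d)
  .{{_ : NonZero a}} .{{_ : NonZero (length (snake ℓ))}}
  (p : ℕ) .{{_ : NonZero p}} (K n c : ℕ) where

  open Graph G using (Vertex; vertices; Adj; adj?)
  open Plane a ℓ
  open Layouts G p K
  open Routes Dart

  H : Graph
  H = Grid (a ∷ ℓ)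

  source target : Direction × Point → Point
  source (dir , p)            = p
  target (horizontal , x , y) = suc x , y
  target (vertical , x , y)   = x , suc y

  module _ (port : Ports) (layout : Layout n plane vertices [] port)
    (load≤ : ∀ dir x y → length (Layout.L layout dir x y) ≤ c) where

    open Layout layout

    labels : Direction × Point → List Dart
    labels (dir , x , y) = L dir x y

    -- A step between grid nodes that remembers the plane edge above it and a permitted label in
    -- `Q`. Loops are erased with respect to this relation, so the labels remain available for
    -- counting.
    record Use (Q : Dart → Set) (g g′ : Node (a ∷ ℓ)) : Set where
      field
        edge       : Direction × Point
        source∈ : Inside plane (source edge)
        target∈ : Inside plane (target edge)
        ends    : (g ≡ ψ (source edge) × g′ ≡ ψ (target edge)) ⊎ (g ≡ ψ (target edge) × g′ ≡ ψ (source edge))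
        label   : Dart
        label∈  : label ∈ labels edge
        label-Q : Q label

    use : ∀ {Q p q} → Step plane L Q p q → Use Q (ψ p) (ψ q)
    use (east {x} {y} i j d∈ Qd)  = record { edge = horizontal , x , y ; source∈ = i ; target∈ = j ; ends = inj₁ (refl , refl) ; label∈ = d∈ ; label-Q = Qd }
    use (west {x} {y} i j d∈ Qd)  = record { edge = horizontal , x , y ; source∈ = i ; target∈ = j ; ends = inj₂ (refl , refl) ; label∈ = d∈ ; label-Q = Qd }
    use (north {x} {y} i j d∈ Qd) = record { edge = vertical , x , y ; source∈ = i ; target∈ = j ; ends = inj₁ (refl , refl) ; label∈ = d∈ ; label-Q = Qd }
    use (south {x} {y} i j d∈ Qd) = record { edge = vertical , x , y ; source∈ = i ; target∈ = j ; ends = inj₂ (refl , refl) ; label∈ = d∈ ; label-Q = Qd }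

    use-sym : ∀ {Q g g′} → Use Q g g′ → Use Q g′ g
    use-sym u = record { Use u hiding (ends) ; ends = [ (λ (p , q) → inj₂ (q , p)) , (λ (p , q) → inj₁ (q , p)) ]′ (Use.ends u) }

    ψ-edge : ∀ edge → Inside plane (source edge) → Inside plane (target edge) → GridAdj (ψ (source edge)) (ψ (target edge))
    ψ-edge (horizontal , x , y) i j = ψ-east i j
    ψ-edge (vertical , x , y)   i j = ψ-north i j

    use-adj : ∀ {Q g g′} → Use Q g g′ → GridAdj g g′
    use-adj u with Use.ends u
    ... | inj₁ (p , q) = subst₂ GridAdj (sym p) (sym q) (ψ-edge (Use.edge u) (Use.source∈ u) (Use.target∈ u))
    ... | inj₂ (p , q) = subst₂ GridAdj (sym p) (sym q)
      (gridAdj-sym {x = ψ (source (Use.edge u))} {ψ (target (Use.edge u))}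
        (ψ-edge (Use.edge u) (Use.source∈ u) (Use.target∈ u)))

    parallel : ∀ edge edge′ → source edge ≡ source edge′ → target edge ≡ target edge′ → edge ≡ edge′
    parallel (horizontal , _) (horizontal , _) refl _ = refl
    parallel (vertical , _)   (vertical , _)   refl _ = refl
    parallel (horizontal , x , y) (vertical , _) refl eq = contradiction (cong proj₁ eq) 1+n≢n
    parallel (vertical , x , y) (horizontal , _) refl eq = contradiction (sym (cong proj₁ eq)) 1+n≢n

    -- From source to target `x + y` grows, so two plane edges cannot be reverses of each other.
    antiparallel : ∀ edge edge′ → source edge ≡ target edge′ → target edge ≢ source edge′
    antiparallel edge edge′ s≡t t≡s = <-asym (lower edge edge′ t≡s) (lower′ edge edge′ s≡t)
      where
      rank : Point → ℕ
      rank (x , y) = x + y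
      rank< : ∀ edge → rank (source edge) < rank (target edge)
      rank< (horizontal , x , y) = ≤-refl
      rank< (vertical , x , y)   = ≤-reflexive (sym (+-suc x y))
      lower : ∀ edge edge′ → target edge ≡ source edge′ → rank (source edge) < rank (source edge′)
      lower edge edge′ eq = subst (λ p → rank (source edge) < rank p) eq (rank< edge)
      lower′ : ∀ edge edge′ → source edge ≡ target edge′ → rank (source edge′) < rank (source edge)
      lower′ edge edge′ eq = subst (λ p → rank (source edge′) < rank p) (sym eq) (rank< edge′)

    -- Each guest edge over a host edge brings its own witness. All witnesses must name the same
    -- plane edge before their labels can be counted in one list.
    same-edge : ∀ {Q Q′ g g′} (u : Use Q g g′) (u′ : Use Q′ g g′) → Use.edge u ≡ Use.edge u′
    same-edge u u′ with Use.ends u | Use.ends u′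
    ... | inj₁ (p , q) | inj₁ (s , t) = parallel _ _
      (ψ-injective (Use.source∈ u) (Use.source∈ u′) (trans (sym p) s)) (ψ-injective (Use.target∈ u) (Use.target∈ u′) (trans (sym q) t))
    ... | inj₂ (p , q) | inj₂ (t , s) = parallel _ _
      (ψ-injective (Use.source∈ u) (Use.source∈ u′) (trans (sym q) s)) (ψ-injective (Use.target∈ u) (Use.target∈ u′) (trans (sym p) t))
    ... | inj₁ (p , q) | inj₂ (s , t) = contradiction
      (ψ-injective (Use.target∈ u) (Use.source∈ u′) (trans (sym q) t))
      (antiparallel (Use.edge u) (Use.edge u′) (ψ-injective (Use.source∈ u) (Use.target∈ u′) (trans (sym p) s)))
    ... | inj₂ (p , q) | inj₁ (t , s) = contradiction
      (ψ-injective (Use.target∈ u) (Use.source∈ u′) (trans (sym p) t))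
      (antiparallel (Use.edge u) (Use.edge u′) (ψ-injective (Use.source∈ u) (Use.target∈ u′) (trans (sym q) s)))

    Of : Vertex × Vertex → Dart → Set
    Of (u , v) d = d ≡ (u , v) ⊎ d ≡ (v , u)

    open LoopErasure (node-≟ {ℓ = a ∷ ℓ}) using (SimplePath; erase-loops)

    simple-path : ∀ {u v} → Adj u v → SimplePath {R = Use (Of (u , v))} (ψ (φ u)) (ψ (φ v))
    simple-path uv = erase-loops (Star.gmap ψ use (between (Graph.complete G _) (Graph.complete G _) uv))

    ρ : Vertex → Vertex → List (Node (a ∷ ℓ))
    ρ u v with adj? u v
    ... | yes uv = SimplePath.path (simple-path uv)
    ... | no _   = []

    ρ-linked : ∀ u v → Linked (Use (Of (u , v))) (ρ u v)
    ρ-linked u v with adj? u v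
    ... | yes uv = SimplePath.linked (simple-path uv)
    ... | no _   = []

    ρ-path : ∀ {u v} → (u , v) ∈ edges G → IsPath H (ψ (φ u)) (ψ (φ v)) (ρ u v)
    ρ-path {u} {v} uv∈ with adj? u v
    ... | no ¬uv = contradiction (proj₂ (∈-filter⁻ (λ (u , v) → adj? u v) {xs = pairs vertices} uv∈)) ¬uv
    ... | yes uv = record
      { starts = starts ; ends = ends ; distinct = distinct
      ; linked = Linked.map (λ {x} {y} → use-adj {_} {x} {y}) linked }
      where open SimplePath (simple-path uv)

    embedding : Embedding G H
    embedding = record
      { φ = ψ ∘ φ
      ; φ-injective = λ {u} {v} eq → φ-inj (Graph.complete G u) (Graph.complete G v)
          (ψ-injective (φ-in (Graph.complete G u)) (φ-in (Graph.complete G v)) eq)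
      ; ρ = ρ
      ; ρ-path = ρ-path
      }

    traversal : ∀ {g g′ u v} → Traverses (g , g′) (ρ u v) → Use (Of (u , v)) g g′
    traversal {u = u} {v} (inj₁ s∈) = Linked-steps (ρ-linked u v) s∈
    traversal {u = u} {v} (inj₂ s∈) = use-sym (Linked-steps (ρ-linked u v) s∈)

    -- Every guest edge routed over the host edge has a dart among the at most `c` labels there.
    -- `edges` lists one orientation only, which may be that dart or its reverse; hence the factor
    -- two.
    load-edge≤ : ∀ g g′ → Embedding.load embedding (g , g′) ≤ c + c
    load-edge≤ g g′ = bound (filter P? (edges G)) refl
      where
      open ≤-Reasoning
      P? : U.Decidable (λ ((u , v) : Vertex × Vertex) → Traverses (g , g′) (ρ u v))
      P? (u , v) = traverses? H (g , g′) (ρ u v)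
      traversed : ∀ {uv} → uv ∈ filter P? (edges G) → Use (Of uv) g g′
      traversed {uv} uv∈ = traversal (proj₂ (∈-filter⁻ P? {v = uv} {xs = edges G} uv∈))
      bound : ∀ es → filter P? (edges G) ≡ es → length es ≤ c + c
      bound []       _  = z≤n
      -- The first traversing guest edge supplies the plane edge; a host edge outside the image of
      -- the plane has no such guest edge.
      bound (e ∷ es) eq = begin
        length (e ∷ es)                              ≤⟨ unique-⊆-length unique sub ⟩
        length (labels edge ++ map swap (labels edge))     ≡⟨ length-++ (labels edge) ⟩
        length (labels edge) + length (map swap (labels edge)) ≡⟨ cong (length (labels edge) +_) (length-map swap (labels edge)) ⟩
        length (labels edge) + length (labels edge)        ≤⟨ +-mono-≤ labels≤ labels≤ ⟩
        c + c                                        ∎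
        where
        u₀ : Use (Of e) g g′
        u₀ = traversed (subst (e ∈_) (sym eq) (here refl))
        open Use u₀ using (edge)
        labels≤ : length (labels edge) ≤ c
        labels≤ = load≤ (proj₁ edge) _ _
        unique : Unique (e ∷ es)
        unique = subst Unique eq (Unique.filter⁺ P? (Unique.filter⁺ (λ (u , v) → adj? u v) (Unique-pairs (Graph.unique G))))
        of-label : ∀ {uv d} → Of uv d → d ∈ labels edge → uv ∈ labels edge ++ map swap (labels edge)
        of-label (inj₁ refl) d∈ = ∈-++⁺ˡ d∈
        of-label (inj₂ refl) d∈ = ∈-++⁺ʳ (labels edge) (∈-map⁺ swap d∈)
        sub : ∀ {uv} → uv ∈ e ∷ es → uv ∈ labels edge ++ map swap (labels edge)
        sub {uv} uv∈ =
          let u = traversed (subst (uv ∈_) (sym eq) uv∈)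
          in of-label (Use.label-Q u) (subst (λ edge → Use.label u ∈ labels edge) (sym (same-edge u₀ u)) (Use.label∈ u))

    congestion≤ : Embedding.edgeCongestion embedding ≤ c + c
    congestion≤ = max≤v⁺ {xs = map (Embedding.load embedding) (edges H)} z≤n
      (Allₚ.map⁺ (All.tabulate λ {(g , g′)} _ → load-edge≤ g g′))

-- Side lengths, aspect ratio and the final constant

log₂ : ∀ n .{{_ : NonZero n}} → ∃[ i ] (2 ^ i ≤ n × n ≤ 2 ^ suc i)
log₂ (suc zero) = 0 , s≤s z≤n , s≤s z≤n
log₂ (suc n@(suc _)) with log₂ n
... | i , lo , hi with suc n ≤? 2 ^ suc i
...   | yes le = i , m≤n⇒m≤1+n lo , le
...   | no nle = suc i , ≤-trans (n≤1+n _) (≰⇒> nle) , (begin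
  suc n                        ≤⟨ +-mono-≤ (m^n>0 2 (suc i)) hi ⟩
  2 ^ suc i + 2 ^ suc i        ≡⟨ cong (2 ^ suc i +_) (+-identityʳ (2 ^ suc i)) ⟨
  2 ^ suc (suc i)              ∎)
  where open ≤-Reasoning

^-cancelʳ-≤ : ∀ {i j} → 2 ^ i ≤ 2 ^ j → i ≤ j
^-cancelʳ-≤ le = ≮⇒≥ λ j<i → <⇒≱ (^-monoʳ-< 2 (s≤s (s≤s z≤n)) j<i) le

length-nodes : ∀ {d} k (ℓ : Vec ℕ d) → length (nodes (k ∷ ℓ)) ≡ k * length (nodes ℓ)
length-nodes k ℓ = trans (sym (length-snake (k ∷ ℓ)))
  (trans (length-snakeRows (allFin k) (snake ℓ)) (cong₂ _*_ (length-tabulate {n = k} id) (length-snake ℓ)))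

nodes≤ : ∀ {d m} (ℓ : Vec ℕ d) → (∀ i → lookup ℓ i ≤ m) → length (nodes ℓ) ≤ m ^ d
nodes≤ []      b = ≤-refl
nodes≤ (k ∷ ℓ) b = subst (_≤ _) (sym (length-nodes k ℓ)) (*-mono-≤ (b zero) (nodes≤ ℓ (b ∘ suc)))

nodes≥1 : ∀ {d} (ℓ : Vec ℕ d) → (∀ i → NonZero (lookup ℓ i)) → 1 ≤ length (nodes ℓ)
nodes≥1 []      nz = ≤-refl
nodes≥1 (k ∷ ℓ) nz = subst (1 ≤_) (sym (length-nodes k ℓ))
  (*-mono-≤ (>-nonZero⁻¹ k {{nz zero}}) (nodes≥1 ℓ (nz ∘ suc)))

fraction≤ : ∀ b a .{{_ : NonZero a}} q → (ℤ.+ b /ℚ a) ℚ.≤ q → b ≤ ℤ.∣ ℚ.↥ q ∣ * a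
fraction≤ b (suc a) q@(mkℚ n d-1 _) le = from n (ℚᵘ.drop-*≤*
  (ℚᵘ.≤-respˡ-≃ (ℚ.toℚᵘ-fromℚᵘ (mkℚᵘ (ℤ.+ b) a)) (ℚ.toℚᵘ-mono-≤ le)))
  where
  from : ∀ n → (ℤ.+ b) ℤ.* (ℤ.+ suc d-1) ℤ.≤ n ℤ.* (ℤ.+ suc a) → b ≤ ℤ.∣ n ∣ * suc a
  from (ℤ.+ k)    le = ≤-trans (m≤m*n b (suc d-1))
    (ℤ.drop‿+≤+ (subst₂ ℤ._≤_ (sym (ℤ.pos-* b (suc d-1))) (sym (ℤ.pos-* k (suc a))) le))
  from -[1+ k ] le with () ← subst (ℤ._≤ -[1+ k ] ℤ.* ℤ.+ suc a) (sym (ℤ.pos-* b (suc d-1))) le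

-- The real `μ` is used only through its approximation at index 0: with the error 1 added it is a
-- rational upper bound for every ratio of sides.
sides≤ : ∀ {d} (ℓ : Vec ℕ d) (ℓ≢0 : ∀ i → NonZero (lookup ℓ i)) (μ : ℝ) → aspectRatio ℓ ℓ≢0 ≤ᴿ μ →
         ∀ i j → lookup ℓ j ≤ ℤ.∣ ℚ.↥ (ℝ.approx μ 0 ℚ.+ (ℤ.+ 1 /ℚ 1)) ∣ * lookup ℓ i
sides≤ {d} ℓ ℓ≢0 μ ratio≤ i j = fraction≤ (lookup ℓ j) (lookup ℓ i) {{ℓ≢0 i}} _
  (ℚ.≤-trans (All.lookup (Extrema.xs≤max 1ℚ (map ratio (cartesianProduct (allFin d) (allFin d))))
    (∈-map⁺ ratio (∈-cartesianProduct⁺ (∈-allFin i) (∈-allFin j)))) (ratio≤ 0))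
  where
  module Extrema = Data.List.Extrema (DecTotalOrder.totalOrder ℚ.≤-decTotalOrder)
  ratio : Fin d × Fin d → ℚ
  ratio (i , j) = _/ℚ_ (ℤ.+ lookup ℓ j) (lookup ℓ i) {{ℓ≢0 i}}

-- With ratios at most `M`, the height `B` of the plane is at most `(M * a) ^ suc d`, and `a` is at
-- most `M * B`. After taking logarithms, with `M` itself as a crude bound for the logarithm of `M`,
-- this value of `q` satisfies both `n≤i` and `n≤j`.
module Assembly (t M d q n₀ : ℕ) .{{_ : NonZero q}} (q≡ : q ≡ 2 + (M + suc M * suc d))
  (roomy : Growth.Roomy t q n₀) where

  private
    module Gr = Growth t q n₀
    instance
      p-nonZero : NonZero Gr.p
      p-nonZero = Gr.p-nonZero

  c₀ : ℕ
  c₀ = Gr.K + 3 * Gr.p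

  2≤q : 2 ≤ q
  2≤q = subst (2 ≤_) (sym q≡) (m≤m+n 2 _)

  embed : (G : Graph) → TreewidthAtMost G t →
    (ℓ : Vec ℕ (suc (suc d))) → (∀ i → NonZero (lookup ℓ i)) → order G ≤ order (Grid ℓ) →
    (∀ i j → lookup ℓ j ≤ M * lookup ℓ i) →
    Σ[ E ∈ Embedding G (Grid ℓ) ] Embedding.edgeCongestion E ≤ 2 * c₀ * maxDegree G
  embed G (D , width≤t) (a ∷ ℓ) ℓ≢0 order≤ side =
    Cong.embedding port layout load≤ ,
    ≤-trans (Cong.congestion≤ port layout load≤) (≤-reflexive (lemma c₀ (maxDegree G)))
    where
    open ≤-Reasoning
    open Graph G using (Vertex; vertices)
    open Count G using (Δ; e; e-[]ʳ)
    lemma : ∀ c δ → c * δ + c * δ ≡ 2 * c * δ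
    lemma = solve-∀
    B : ℕ
    B = length (snake ℓ)
    instance
      a-nonZero : NonZero a
      a-nonZero = ℓ≢0 zero
      B-nonZero : NonZero B
      B-nonZero = >-nonZero (subst (1 ≤_) (sym (length-snake ℓ)) (nodes≥1 ℓ (ℓ≢0 ∘ suc)))
    separation : (S : List Vertex) → Unique S → 1 ≤ length S → Separation G (suc t) S
    separation S u 1≤ = record { Separation s hiding (middle≤) ; middle≤ = ≤-trans (Separation.middle≤ s) (s≤s width≤t) }
      where s = Separator.separation G D S u 1≤
    open Layouts G Gr.p Gr.K
    -- No edge leaves the whole vertex set, so the value is arbitrary.
    port : Ports
    port _ = 0 , 0
    no-darts : ∀ S → length (darts S []) ≡ 0
    no-darts S = trans (length-darts S []) (e-[]ʳ S)
    i j : ℕ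
    i = proj₁ (log₂ a)
    j = proj₁ (log₂ B)
    j≤ : j ≤ (M + suc i) * suc d
    j≤ = ^-cancelʳ-≤ (begin
      2 ^ j                              ≤⟨ proj₁ (proj₂ (log₂ B)) ⟩
      B                                  ≡⟨ length-snake ℓ ⟩
      length (nodes ℓ)                   ≤⟨ nodes≤ ℓ (λ k → side zero (suc k)) ⟩
      (M * a) ^ suc d                    ≤⟨ ^-monoˡ-≤ (suc d) (*-mono-≤ (<⇒≤ (n<2^n M)) (proj₂ (proj₂ (log₂ a)))) ⟩
      (2 ^ M * 2 ^ suc i) ^ suc d        ≡⟨ cong (_^ suc d) (^-distribˡ-+-* 2 M (suc i)) ⟨
      (2 ^ (M + suc i)) ^ suc d          ≡⟨ ^-*-assoc 2 (M + suc i) (suc d) ⟩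
      2 ^ ((M + suc i) * suc d)          ∎)
    first≤ : ∀ {d′} (ℓ : Vec ℕ (suc d′)) → (∀ i → NonZero (lookup ℓ i)) → lookup ℓ zero ≤ length (nodes ℓ)
    first≤ (k ∷ ℓ) nz = subst (k ≤_) (sym (length-nodes k ℓ))
      (subst (_≤ k * length (nodes ℓ)) (*-identityʳ k) (*-monoʳ-≤ k (nodes≥1 ℓ (nz ∘ suc))))
    i≤ : i ≤ M + suc j
    i≤ = ^-cancelʳ-≤ (begin
      2 ^ i                              ≤⟨ proj₁ (proj₂ (log₂ a)) ⟩
      a                                  ≤⟨ side (suc zero) zero ⟩
      M * lookup ℓ zero              ≤⟨ *-mono-≤ (<⇒≤ (n<2^n M)) (begin
        lookup ℓ zero                  ≤⟨ first≤ ℓ (ℓ≢0 ∘ suc) ⟩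
        length (nodes ℓ)                   ≡⟨ length-snake ℓ ⟨
        B                                  ≤⟨ proj₂ (proj₂ (log₂ B)) ⟩
        2 ^ suc j                          ∎) ⟩
      2 ^ M * 2 ^ suc j                  ≡⟨ ^-distribˡ-+-* 2 M (suc j) ⟨
      2 ^ (M + suc j)                    ∎)
    n≤i : i + j ≤ q * suc i
    n≤i = begin
      i + j                              ≤⟨ +-monoʳ-≤ i j≤ ⟩
      i + (M + suc i) * suc d            ≤⟨ m≤m+n _ (2 + i + M * suc i + M * i * suc d) ⟩
      i + (M + suc i) * suc d + (2 + i + M * suc i + M * i * suc d)  ≡⟨ lemma′ i M d ⟩
      (2 + (M + suc M * suc d)) * suc i  ≡⟨ cong (_* suc i) q≡ ⟨
      q * suc i                          ∎
      where
      lemma′ : ∀ i M d → i + (M + (1 + i)) * (1 + d) + (2 + i + M * (1 + i) + M * i * (1 + d))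
               ≡ (2 + (M + (1 + M) * (1 + d))) * (1 + i)
      lemma′ = solve-∀
    n≤j : i + j ≤ q * suc j
    n≤j = begin
      i + j                              ≤⟨ +-monoˡ-≤ j i≤ ⟩
      M + suc j + j                      ≤⟨ m≤m+n _ (1 + M * j + suc M * suc d * suc j) ⟩
      M + suc j + j + (1 + M * j + suc M * suc d * suc j) ≡⟨ lemma′ j M d ⟩
      (2 + (M + suc M * suc d)) * suc j  ≡⟨ cong (_* suc j) q≡ ⟨
      q * suc j                          ∎
      where
      lemma′ : ∀ j M d → M + (1 + j) + j + (1 + M * j + (1 + M) * (1 + d) * (1 + j))
               ≡ (2 + (M + (1 + M) * (1 + d))) * (1 + j)
      lemma′ = solve-∀
    layout : Layout (i + j) (Plane.plane a ℓ) vertices [] port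
    layout = Gr.layouts (roomy) G separation 2≤q (i + j) i j (Plane.plane a ℓ) vertices [] port record
      { i+j≡n = refl
      ; width≥ = proj₁ (proj₂ (log₂ a)) ; width≤ = proj₂ (proj₂ (log₂ a))
      ; height≥ = proj₁ (proj₂ (log₂ B)) ; height≤ = proj₂ (proj₂ (log₂ B))
      ; n≤i = n≤i ; n≤j = n≤j
      ; unique = Unique.++⁺ (Graph.unique G) [] (λ ())
      ; fits = ≤-trans order≤ (≤-reflexive (trans (length-nodes a ℓ) (cong (a *_) (sym (length-snake ℓ)))))
      ; ext≤ = ≤-trans (≤-reflexive (e-[]ʳ vertices)) z≤n
      ; ports-in = λ {d} d∈ → contradiction (∈-length d∈) (<⇒≱ (s≤s (≤-reflexive (no-darts vertices))))
      }
    load≤ : ∀ dir x y → length (Layout.L layout dir x y) ≤ c₀ * Δ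
    load≤ horizontal x y = begin
      length (Layout.L layout horizontal x y)               ≤⟨ Layout.row-load layout x y ⟩
      load (i + j) y + length (inRow port (darts vertices []) y) ≤⟨ +-mono-≤ (Gr.load≤ (roomy) G separation (i + j) y) (≤-trans (length-filter _ (darts vertices [])) (≤-reflexive (no-darts vertices))) ⟩
      c₀ * Δ + 0                             ≡⟨ +-identityʳ _ ⟩
      c₀ * Δ                                 ∎
    load≤ vertical x y = begin
      length (Layout.L layout vertical x y)                 ≤⟨ Layout.col-load layout x y ⟩
      load (i + j) x + length (inCol port (darts vertices []) x) ≤⟨ +-mono-≤ (Gr.load≤ (roomy) G separation (i + j) x) (≤-trans (length-filter _ (darts vertices [])) (≤-reflexive (no-darts vertices))) ⟩
      c₀ * Δ + 0                             ≡⟨ +-identityʳ _ ⟩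
      c₀ * Δ                                 ∎
    module Cong = Congestion G a ℓ Gr.p Gr.K (i + j) (c₀ * Δ)

corollary2 : (t d : ℕ) → 2 ≤ d → (μ : ℝ) → 1ℚ ≤ᴿ μ →
    ∃[ C ] ((G : Graph) → TreewidthAtMost G t →
    (ℓ : Vec ℕ d) (ℓ≢0 : ∀ i → NonZero (lookup ℓ i)) →
    order G ≤ order (Grid ℓ) → aspectRatio ℓ ℓ≢0 ≤ᴿ μ →
    Σ[ E ∈ Embedding G (Grid ℓ) ]
    Embedding.edgeCongestion E ≤ C * maxDegree G)
corollary2 t (suc zero) (s≤s ())
corollary2 t (suc (suc d)) 2≤d μ 1≤μ =
  let M = ℤ.∣ ℚ.↥ (ℝ.approx μ 0 ℚ.+ (ℤ.+ 1 /ℚ 1)) ∣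
      q = 2 + (M + suc M * suc d)
      n₀ , roomy = roomy-exists t q
      open Assembly t M d q n₀ refl roomy
  -- `c₀` is built from `t`, `q` and `n₀` only, and these from `t`, `d` and `μ`; the factor 2 is the
  -- one of `load-edge≤`.
  in 2 * c₀ , λ G tw ℓ ℓ≢0 order≤ ratio≤ → embed G tw ℓ ℓ≢0 order≤ (sides≤ ℓ ℓ≢0 μ ratio≤)
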